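{- Let $\eta=(\eta_1,\dots,\eta_r)$ be a composition of $n$. Then, as formal power series in $t$ with coefficients in $\mathbb{Q}(q)$, $$\frac{C_{B_{\eta}}(q,t)}{\prod_{i=0}^n(1-q^i t)} = \sum_{k\geq 0} \left( \prod_{i=1}^r \sum_{j= 0}^{\eta_i} q^{\frac{j(j-1)}{2}} \binom{\eta_i}{j}_q \binom{k-j+\eta_i}{\eta_i}_q \right) t^k= \mathrm{Ehr}_{\lozenge_{\eta}, \bar{\boldsymbol{\mu}}_{\eta}}(q,t).$$
   Context: $S_\eta$ is the set of multiset permutations $w=w_1\dots w_n$ of the multiset with $\eta_j$ copies of $j$, $j\in[r]$. $B_\eta$ is the set of signed multiset permutations: pairs $(w,\epsilon)$ with $w\in S_\eta$ and $\epsilon:[n]\to\{\pm1\}$ (written as $w_1^{\pm}\dots w_n^{\pm}$ with the sign $\epsilon(i)$ on $w_i$). The standardisation $\mathrm{std}(w)\in S_n$ of $w\in S_\eta$ replaces the $\eta_1$ ones from left to right by $1,\dots,\eta_1$, the $\eta_2$ twos from left to right by $\eta_1+1,\dots,\eta_1+\eta_2$, etc.; for $(w,\epsilon)$ put $\mathrm{std}(w,\epsilon)=(\mathrm{std}(w),\epsilon)$, viewed as the sequence of integers $\epsilon(i)\,\mathrm{std}(w)_i$. The descent set is $\mathrm{Des}(w,\epsilon)=\{i\in\{0,1,\dots,n-1\}: \mathrm{std}(w,\epsilon)_i>\mathrm{std}(w,\epsilon)_{i+1}\}$ with $\mathrm{std}(w,\epsilon)_0:=0$ (comparisons in the usual order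 of $\mathbb{Z}$); $\mathrm{maj}=\sum_{i\in\mathrm{Des}} i$, $\mathrm{des}=|\mathrm{Des}|$, and $C_{B_\eta}(q,t)=\sum_{w\in B_\eta}q^{\mathrm{maj}(w)}t^{\mathrm{des}(w)}$. The $q$-binomial is $\binom{m}{j}_q=\frac{[m]_q!}{[m-j]_q![j]_q!}$, $[m]_q=\frac{1-q^m}{1-q}$ (and $\binom{m}{j}_q=0$ when $m<j$, $m\ge0$ as needed). The cross polytope is $\lozenge_m=\{x\in\mathbb{R}^m:|x_1|+\dots+|x_m|\le1\}$ and $\lozenge_\eta=\lozenge_{\eta_1}\times\dots\times\lozenge_{\eta_r}\subset\mathbb{R}^n$. For $k\ge0$ and $y\in k\Delta_m\cap\mathbb{Z}^m$ (where $\Delta_m=\{y\ge0,\sum y_i\le1\}$) let $\mu_{k,m}(y)=\sum_{i=1}^m\bigl(k-\sum_{l=i}^m y_l\bigr)$. For $x=(x_1,\dots,x_r)\in k\lozenge_\eta\cap\mathbb{Z}^n$ with $x_i\in k\lozenge_{\eta_i}$ set $\bar\mu_{k,\eta}(x)=\sum_{i=1}^r\mu_{k,\eta_i}(|x_i|)$, where $|\cdot|$ is the coordinatewise absolute value. Then $\mathrm{Ehr}_{\lozenge_\eta,\bar{\boldsymbol\mu}_\eta}(q,t)=\sum_{k\ge0}\sum_{x\in k\lozenge_\eta\cap\mathbb{Z}^n}q^{\bar\mu_{k,\eta}(x)}t^k$. -}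

module Defs where

open import Data.Bool using (Bool; true; false; if_then_else_; not; _∧_)
open import Data.Nat as ℕ using (ℕ; zero; suc; _∸_; _≡ᵇ_)
open import Data.Nat.DivMod using (_/_)
open import Data.Integer as ℤ using (ℤ; +_; -_; ∣_∣)
open import Data.Nat.ListAction using (sum)
open import Data.List using (List; []; _∷_; map; foldr; length; take; concatMap; applyUpTo; zipWith)

sumTo : ℕ → (ℕ → ℤ) → ℤ
sumTo zero    f = f zero
sumTo (suc m) f = sumTo m f ℤ.+ f (suc m)

-- A polynomial / power series in q with integer coefficients:
-- the function  a ↦ [q^a]
Poly : Set
Poly = ℕ → ℤ

polyAdd : Poly → Poly → Poly
polyAdd f g a = f a ℤ.+ g a

polyMul : Poly → Poly → Poly
polyMul f g a = sumTo a (λ i → f i ℤ.* g (a ∸ i))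

polyOne : Poly
polyOne a = if a ≡ᵇ 0 then + 1 else + 0

qPow : ℕ → Poly
qPow d a = if a ≡ᵇ d then + 1 else + 0

polyZero : Poly
polyZero _ = + 0

-- Gaussian (q-)binomial coefficient  binom(m, j)_q  as a polynomial in q,
-- computed by the q-Pascal rule
--   binom(m+1, j+1) = binom(m, j) + q^(j+1) binom(m, j+1);
-- binom(m, 0) = 1 and binom(0, j+1) = 0 (so binom(m, j) = 0 when m < j).
-- This is the polynomial [m]_q! / ([m-j]_q! [j]_q!) (for j ≤ m).
qbinom : ℕ → ℕ → Poly
qbinom m       zero    = polyOne
qbinom zero    (suc j) = polyZero
qbinom (suc m) (suc j) = polyAdd (qbinom m j) (polyMul (qPow (suc j)) (qbinom m (suc j)))

-- A formal power series in t whose coefficients are polynomials in q: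
-- S k a = [t^k q^a] S
Ser : Set
Ser = ℕ → Poly

serMul : Ser → Ser → Ser
serMul f g k a = sumTo k (λ i → polyMul (f i) (g (k ∸ i)) a)

factor : ℕ → Ser
factor i zero          = polyOne
factor i (suc zero)    = λ a → - qPow i a
factor i (suc (suc _)) = polyZero

prodFactors : ℕ → Ser
prodFactors zero    = factor zero
prodFactors (suc n) = serMul (prodFactors n) (factor (suc n))

countᵇ : {A : Set} → (A → Bool) → List A → ℕ
countᵇ p []       = zero
countᵇ p (x ∷ xs) = if p x then suc (countᵇ p xs) else countᵇ p xs

filterᵇ' : {A : Set} → (A → Bool) → List A → List A
filterᵇ' p []       = []
filterᵇ' p (x ∷ xs) = if p x then x ∷ filterᵇ' p xs else filterᵇ' p xs

eqListℕ : List ℕ → List ℕ → Bool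
eqListℕ []       []       = true
eqListℕ (x ∷ xs) (y ∷ ys) = (x ≡ᵇ y) ∧ eqListℕ xs ys
eqListℕ _        _        = false

occ : ℕ → List ℕ → ℕ
occ c w = countᵇ (λ x → x ≡ᵇ c) w

-- Multiset permutations S_η and signed multiset permutations B_η
-- A composition η = (η_1,…,η_r) is a list of natural numbers; n = sum η.

words : ℕ → ℕ → List (List ℕ)
words zero    r = [] ∷ []
words (suc ℓ) r = concatMap (λ w → applyUpTo (λ c → suc c ∷ w) r) (words ℓ r)

Sη : List ℕ → List (List ℕ)
Sη η = filterᵇ' (λ w → eqListℕ (applyUpTo (λ j → occ (suc j) w) (length η)) η)
                (words (sum η) (length η))

-- all sign vectors ε : [ℓ] → {±1}, encoded as Bool (true = +1, false = -1)
signs : ℕ → List (List Bool)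
signs zero    = [] ∷ []
signs (suc ℓ) = concatMap (λ s → (true ∷ s) ∷ (false ∷ s) ∷ []) (signs ℓ)

record Signed : Set where
  constructor _,ε_
  field
    word : List ℕ
    sgn  : List Bool

Bη : List ℕ → List Signed
Bη η = concatMap (λ w → map (λ e → w ,ε e) (signs (sum η))) (Sη η)

stdGo : List ℕ → List ℕ → List ℕ → List ℕ
stdGo η pre []      = []
stdGo η pre (c ∷ w) = (sum (take (c ∸ 1) η) ℕ.+ occ c pre ℕ.+ 1) ∷ stdGo η (c ∷ pre) w

std : List ℕ → List ℕ → List ℕ
std η w = stdGo η [] w

applySign : Bool → ℕ → ℤ
applySign true  v = + v
applySign false v = - (+ v)

stdSigned : List ℕ → Signed → List ℤ
stdSigned η (w ,ε e) = zipWith applySign e (std η w)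

_>ᵇ_ : ℤ → ℤ → Bool
a >ᵇ b = not (a ℤ.≤ᵇ b)

desGo : ℕ → List ℤ → List ℕ
desGo i []            = []
desGo i (a ∷ [])      = []
desGo i (a ∷ b ∷ rest) = if a >ᵇ b then i ∷ desGo (suc i) (b ∷ rest) else desGo (suc i) (b ∷ rest)

-- Des(w, ε) ⊆ {0,…,n-1}, with std(w,ε)_0 := 0
Des : List ℕ → Signed → List ℕ
Des η x = desGo 0 (+ 0 ∷ stdSigned η x)

maj : List ℕ → Signed → ℕ
maj η x = sum (Des η x)

des : List ℕ → Signed → ℕ
des η x = length (Des η x)

-- C_{B_η}(q,t) = Σ_{x ∈ B_η} q^{maj x} t^{des x};  [t^k q^a]
CB : List ℕ → Ser
CB η k a = + countᵇ (λ x → (des η x ≡ᵇ k) ∧ (maj η x ≡ᵇ a)) (Bη η)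

polySumTo : ℕ → (ℕ → Poly) → Poly
polySumTo m f a = sumTo m (λ j → f j a)

midFactor : ℕ → ℕ → Poly
midFactor k e = polySumTo e (λ j →
  polyMul (qPow ((j ℕ.* (j ∸ 1)) / 2))
          (polyMul (qbinom e j) (qbinom (k ℕ.+ e ∸ j) e)))

Mid : List ℕ → Ser
Mid η k = foldr (λ e p → polyMul (midFactor k e) p) polyOne η

intRange : ℕ → List ℤ
intRange k = applyUpTo (λ i → + i ℤ.- + k) (suc (k ℕ.+ k))

intVecs : ℕ → ℕ → List (List ℤ)
intVecs zero    k = [] ∷ []
intVecs (suc m) k = concatMap (λ v → map (λ z → z ∷ v) (intRange k)) (intVecs m k)

absList : List ℤ → List ℕ
absList = map ∣_∣

crossPts : ℕ → ℕ → List (List ℤ)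
crossPts m k = filterᵇ' (λ v → sum (absList v) ℕ.≤ᵇ k) (intVecs m k)

-- k ◇_η ∩ ℤ^n, as lists of blocks x = (x_1, …, x_r), x_i ∈ k ◇_{η_i}
latticePts : List ℕ → ℕ → List (List (List ℤ))
latticePts []      k = [] ∷ []
latticePts (e ∷ η) k = concatMap (λ x → map (λ rest → x ∷ rest) (latticePts η k)) (crossPts e k)

-- μ_{k,m}(y) = Σ_{i=1}^m (k − Σ_{l=i}^m y_l)   (each term is ≥ 0 on k Δ_m)
mu : ℕ → List ℕ → ℕ
mu k []      = zero
mu k (y ∷ ys) = (k ∸ sum (y ∷ ys)) ℕ.+ mu k ys

muBar : ℕ → List (List ℤ) → ℕ
muBar k x = sum (map (λ xi → mu k (absList xi)) x)

Ehr : List ℕ → Ser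
Ehr η k a = + countᵇ (λ x → muBar k x ≡ᵇ a) (latticePts η k)

{-# OPTIONS --safe #-}

-- Both sides are compared with E(m,k), the weighted number of lattice points of k ◇_m.  Reading
-- the partial sums c_i = k − (|x_i| + … + |x_m|) as a weakly increasing sequence bounded by k
-- gives  E(m+1,k+1) = E(m+1,k) + q^k E(m,k) + q^(k+1) E(m,k+1),  which is also the recurrence of
-- ∏_{i<m} (1 + q^i t) / ∏_{i≤m} (1 − q^i t), i.e. of the q-binomial sums.
--
-- For the descent side, C/∏(1 − q^i t) counts signed words with a sequence k ≥ a_1 ≥ … ≥ a_n ≥ 0
-- that is strict at the descents.  On a run of equal values the word has no descent, so the
-- letters carrying that value are determined by their multiplicities, each absolute value
-- occurring with sign −1 at most once.  Hence the count N is a product over the letters of factors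
-- close to E, depending on the previous letter; splitting off the first letter, the products
-- telescope along the order of the signed letters, which yields
-- N(t) = t N(t) + Σ_y t^[y is a descent] N_y(qt).  The polynomials C satisfy the same recursion
-- without the term t N(t).
module Submission where

open import Algebra using (CommutativeRing)
open import Data.Bool as Bool using (Bool; true; false; if_then_else_; not; _∧_)
open import Data.Bool.Properties using (∧-conicalˡ; ∧-conicalʳ)
open import Data.Integer as ℤ using (ℤ; ∣_∣; +_)
import Data.Integer.Properties as ℤₚ
open import Data.List using (List; []; _∷_; _++_; map; concatMap; applyUpTo; length; take; zipWith)
open import Data.List.Properties using (length-map)
open import Data.List.Relation.Unary.All as All using (All; []; _∷_)
import Data.List.Relation.Unary.All.Properties as Allₚ
open import Data.Maybe as Maybe using (Maybe; just; nothing; maybe)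
open import Data.Nat as ℕ using (ℕ; zero; suc; _∸_; _≡ᵇ_; _<ᵇ_; _<_)
open import Data.Nat.DivMod using (_/_; +-distrib-/-∣ˡ; m*n/n≡m)
open import Data.Nat.Divisibility using (n∣m*n)
open import Data.Nat.ListAction using (sum)
import Data.Nat.Properties as ℕₚ
open import Data.Nat.Tactic.RingSolver using (solve-∀)
open import Data.Product using (_×_; _,_; proj₁; proj₂)
open import Data.Sum using (inj₁; inj₂)
open import Data.Unit using (tt)
open import Function using (_∘_)
open import Level using (Level)
import Relation.Binary.Reasoning.Setoid as SetoidReasoning
open import Relation.Binary.PropositionalEquality as ≡ using (_≡_; _≢_)
open import Relation.Nullary using (yes; no; contradiction)
open import Defs

-- Finite sums and formal power series

module FiniteSums {c ℓ : Level} (R : CommutativeRing c ℓ) where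
  open CommutativeRing R hiding (zero)
  open SetoidReasoning setoid
  open import Algebra.Solver.Ring.NaturalCoefficients.Default commutativeSemiring
    using (solve; _:+_; _:=_)

  private
    variable
      A B : Set

  interchange : ∀ a b c d → (a + b) + (c + d) ≈ (a + c) + (b + d)
  interchange = solve 4 (λ a b c d → (a :+ b) :+ (c :+ d) := (a :+ c) :+ (b :+ d)) refl

  ∑ : List A → (A → Carrier) → Carrier
  ∑ []       f = 0#
  ∑ (x ∷ xs) f = f x + ∑ xs f

  ∑< : ℕ → (ℕ → Carrier) → Carrier
  ∑< zero    f = 0#
  ∑< (suc n) f = f 0 + ∑< n (f ∘ suc)

  ∑-cong-All : ∀ {xs : List A} {f g} → All (λ x → f x ≈ g x) xs → ∑ xs f ≈ ∑ xs g
  ∑-cong-All []       = refl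
  ∑-cong-All (p ∷ ps) = +-cong p (∑-cong-All ps)

  ∑-cong : ∀ (xs : List A) {f g} → (∀ x → f x ≈ g x) → ∑ xs f ≈ ∑ xs g
  ∑-cong []       p = refl
  ∑-cong (x ∷ xs) p = +-cong (p x) (∑-cong xs p)

  ∑-zero : ∀ (xs : List A) → ∑ xs (λ _ → 0#) ≈ 0#
  ∑-zero []       = refl
  ∑-zero (x ∷ xs) = trans (+-identityˡ _) (∑-zero xs)

  ∑-+ : ∀ (xs : List A) (f g : A → Carrier) → ∑ xs (λ x → f x + g x) ≈ ∑ xs f + ∑ xs g
  ∑-+ []       f g = sym (+-identityˡ 0#)
  ∑-+ (x ∷ xs) f g = trans (+-congˡ (∑-+ xs f g)) (interchange _ _ _ _)

  ∑-*ˡ : ∀ (xs : List A) a (f : A → Carrier) → ∑ xs (λ x → a * f x) ≈ a * ∑ xs f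
  ∑-*ˡ []       a f = sym (zeroʳ a)
  ∑-*ˡ (x ∷ xs) a f = trans (+-congˡ (∑-*ˡ xs a f)) (sym (distribˡ a _ _))

  ∑-*ʳ : ∀ (xs : List A) (f : A → Carrier) a → ∑ xs (λ x → f x * a) ≈ ∑ xs f * a
  ∑-*ʳ []       f a = sym (zeroˡ a)
  ∑-*ʳ (x ∷ xs) f a = trans (+-congˡ (∑-*ʳ xs f a)) (sym (distribʳ a _ _))

  ∑-++ : ∀ (xs ys : List A) f → ∑ (xs ++ ys) f ≈ ∑ xs f + ∑ ys f
  ∑-++ []       ys f = sym (+-identityˡ _)
  ∑-++ (x ∷ xs) ys f = trans (+-congˡ (∑-++ xs ys f)) (sym (+-assoc _ _ _))

  ∑-concatMap : ∀ (h : B → List A) xs f → ∑ (concatMap h xs) f ≈ ∑ xs (λ x → ∑ (h x) f)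
  ∑-concatMap h []       f = refl
  ∑-concatMap h (x ∷ xs) f = trans (∑-++ (h x) _ f) (+-congˡ (∑-concatMap h xs f))

  ∑-map : ∀ (h : B → A) xs f → ∑ (map h xs) f ≈ ∑ xs (f ∘ h)
  ∑-map h []       f = refl
  ∑-map h (x ∷ xs) f = +-congˡ (∑-map h xs f)

  ∑-applyUpTo : ∀ (h : ℕ → A) n f → ∑ (applyUpTo h n) f ≈ ∑< n (f ∘ h)
  ∑-applyUpTo h zero    f = refl
  ∑-applyUpTo h (suc n) f = +-congˡ (∑-applyUpTo (h ∘ suc) n f)

  ∑-filter : ∀ (p : A → Bool) xs f → ∑ (filterᵇ' p xs) f ≈ ∑ xs (λ x → if p x then f x else 0#)
  ∑-filter p []       f = refl
  ∑-filter p (x ∷ xs) f with p x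
  ... | true  = +-congˡ (∑-filter p xs f)
  ... | false = trans (∑-filter p xs f) (sym (+-identityˡ _))

  ∑<-cong : ∀ n {f g} → (∀ i → i ℕ.< n → f i ≈ g i) → ∑< n f ≈ ∑< n g
  ∑<-cong zero    p = refl
  ∑<-cong (suc n) p = +-cong (p 0 ℕ.z<s) (∑<-cong n (λ i i<n → p (suc i) (ℕ.s<s i<n)))

  ∑<-zero : ∀ n → ∑< n (λ _ → 0#) ≈ 0#
  ∑<-zero zero    = refl
  ∑<-zero (suc n) = trans (+-identityˡ _) (∑<-zero n)

  ∑<-+ : ∀ n f g → ∑< n (λ i → f i + g i) ≈ ∑< n f + ∑< n g
  ∑<-+ zero    f g = sym (+-identityˡ 0#)
  ∑<-+ (suc n) f g = trans (+-congˡ (∑<-+ n (f ∘ suc) (g ∘ suc))) (interchange _ _ _ _)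

  ∑<-*ˡ : ∀ n a f → ∑< n (λ i → a * f i) ≈ a * ∑< n f
  ∑<-*ˡ zero    a f = sym (zeroʳ a)
  ∑<-*ˡ (suc n) a f = trans (+-congˡ (∑<-*ˡ n a (f ∘ suc))) (sym (distribˡ a _ _))

  ∑<-last : ∀ n f → ∑< (suc n) f ≈ ∑< n f + f n
  ∑<-last zero    f = trans (+-identityʳ _) (sym (+-identityˡ _))
  ∑<-last (suc n) f = trans (+-congˡ (∑<-last n (f ∘ suc))) (sym (+-assoc _ _ _))

  ∑-∑< : ∀ (xs : List A) n (f : A → ℕ → Carrier) →
         ∑ xs (λ x → ∑< n (f x)) ≈ ∑< n (λ i → ∑ xs (λ x → f x i))
  ∑-∑< []       n f = sym (∑<-zero n)
  ∑-∑< (x ∷ xs) n f = trans (+-congˡ (∑-∑< xs n f)) (sym (∑<-+ n _ _))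

  ∑<-vanish : ∀ n d f → (∀ i → n ℕ.≤ i → f i ≈ 0#) → ∑< (n ℕ.+ d) f ≈ ∑< n f
  ∑<-vanish zero    zero    f v = refl
  ∑<-vanish zero    (suc d) f v =
    trans (+-cong (v 0 ℕ.z≤n) (∑<-vanish zero d (f ∘ suc) (λ i _ → v (suc i) ℕ.z≤n)))
          (+-identityˡ 0#)
  ∑<-vanish (suc n) d       f v =
    +-congˡ (∑<-vanish n d (f ∘ suc) (λ i n≤i → v (suc i) (ℕ.s≤s n≤i)))

module PowerSeries {c ℓ : Level} (R : CommutativeRing c ℓ) where
  open CommutativeRing R hiding (zero)
  open FiniteSums R
  open SetoidReasoning setoid
  open import Algebra.Solver.Ring.NaturalCoefficients.Default commutativeSemiring
    using (solve; _:+_; _:*_; _:=_)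

  Series : Set c
  Series = ℕ → Carrier

  infix 4 _≋_
  _≋_ : Series → Series → Set ℓ
  f ≋ g = ∀ n → f n ≈ g n

  infixl 7 _⊛_
  -- Recursion on the degree keeps truncated subtraction out of the ring laws; `⊛-as-∑` recovers the
  -- usual convolution sum.
  _⊛_ : Series → Series → Series
  (f ⊛ g) zero    = f 0 * g 0
  (f ⊛ g) (suc n) = f 0 * g (suc n) + ((f ∘ suc) ⊛ g) n

  constant : Carrier → Series
  constant a zero    = a
  constant a (suc n) = 0#

  shift : Series → Series
  shift f zero    = 0#
  shift f (suc n) = f n

  ⊛-cong : ∀ {f f′ g g′} → f ≋ f′ → g ≋ g′ → f ⊛ g ≋ f′ ⊛ g′
  ⊛-cong p r zero    = *-cong (p 0) (r 0)
  ⊛-cong p r (suc n) = +-cong (*-cong (p 0) (r (suc n))) (⊛-cong (p ∘ suc) r n)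

  ⊛-last : ∀ f g n → (f ⊛ g) (suc n) ≈ f (suc n) * g 0 + (f ⊛ (g ∘ suc)) n
  ⊛-last f g zero    = +-comm _ _
  ⊛-last f g (suc n) = begin
    f 0 * g (suc (suc n)) + ((f ∘ suc) ⊛ g) (suc n)
      ≈⟨ +-congˡ (⊛-last (f ∘ suc) g n) ⟩
    f 0 * g (suc (suc n)) + (f (suc (suc n)) * g 0 + ((f ∘ suc) ⊛ (g ∘ suc)) n)
      ≈⟨ solve 3 (λ a b c → a :+ (b :+ c) := b :+ (a :+ c)) refl _ _ _ ⟩
    f (suc (suc n)) * g 0 + (f 0 * g (suc (suc n)) + ((f ∘ suc) ⊛ (g ∘ suc)) n) ∎

  ⊛-comm : ∀ f g → f ⊛ g ≋ g ⊛ f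
  ⊛-comm f g zero    = *-comm _ _
  ⊛-comm f g (suc n) = trans (+-cong (*-comm _ _) (⊛-comm (f ∘ suc) g n)) (sym (⊛-last g f n))

  ⊛-distribʳ : ∀ h f g → (λ n → f n + g n) ⊛ h ≋ (λ n → (f ⊛ h) n + (g ⊛ h) n)
  ⊛-distribʳ h f g zero    = distribʳ _ _ _
  ⊛-distribʳ h f g (suc n) = begin
    (f 0 + g 0) * h (suc n) + ((λ n → f (suc n) + g (suc n)) ⊛ h) n
      ≈⟨ +-congˡ (⊛-distribʳ h (f ∘ suc) (g ∘ suc) n) ⟩
    (f 0 + g 0) * h (suc n) + (((f ∘ suc) ⊛ h) n + ((g ∘ suc) ⊛ h) n)
      ≈⟨ solve 5 (λ a b c d e → (a :+ b) :* c :+ (d :+ e) := (a :* c :+ d) :+ (b :* c :+ e))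
               refl _ _ _ _ _ ⟩
    (f 0 * h (suc n) + ((f ∘ suc) ⊛ h) n) + (g 0 * h (suc n) + ((g ∘ suc) ⊛ h) n) ∎

  ⊛-scaleˡ : ∀ a f g → (λ n → a * f n) ⊛ g ≋ (λ n → a * (f ⊛ g) n)
  ⊛-scaleˡ a f g zero    = *-assoc _ _ _
  ⊛-scaleˡ a f g (suc n) =
    trans (+-cong (*-assoc _ _ _) (⊛-scaleˡ a (f ∘ suc) g n)) (sym (distribˡ a _ _))

  ⊛-assoc : ∀ f g h → (f ⊛ g) ⊛ h ≋ f ⊛ (g ⊛ h)
  ⊛-assoc f g h zero    = *-assoc _ _ _
  ⊛-assoc f g h (suc n) = begin
    f 0 * g 0 * h (suc n) + ((λ k → f 0 * g (suc k) + ((f ∘ suc) ⊛ g) k) ⊛ h) n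
      ≈⟨ +-congˡ (⊛-distribʳ h (λ k → f 0 * g (suc k)) ((f ∘ suc) ⊛ g) n) ⟩
    f 0 * g 0 * h (suc n) + (((λ k → f 0 * g (suc k)) ⊛ h) n + (((f ∘ suc) ⊛ g) ⊛ h) n)
      ≈⟨ +-congˡ (+-cong (⊛-scaleˡ (f 0) (g ∘ suc) h n) (⊛-assoc (f ∘ suc) g h n)) ⟩
    f 0 * g 0 * h (suc n) + (f 0 * ((g ∘ suc) ⊛ h) n + ((f ∘ suc) ⊛ (g ⊛ h)) n)
      ≈⟨ solve 5 (λ a b c d e → a :* b :* c :+ (a :* d :+ e) := a :* (b :* c :+ d) :+ e)
               refl _ _ _ _ _ ⟩
    f 0 * (g 0 * h (suc n) + ((g ∘ suc) ⊛ h) n) + ((f ∘ suc) ⊛ (g ⊛ h)) n ∎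

  ⊛-zeroˡ : ∀ f → (λ _ → 0#) ⊛ f ≋ (λ _ → 0#)
  ⊛-zeroˡ f zero    = zeroˡ _
  ⊛-zeroˡ f (suc n) = trans (+-cong (zeroˡ _) (⊛-zeroˡ f n)) (+-identityˡ _)

  ⊛-constantˡ : ∀ a f → constant a ⊛ f ≋ (λ n → a * f n)
  ⊛-constantˡ a f zero    = refl
  ⊛-constantˡ a f (suc n) = trans (+-congˡ (⊛-zeroˡ f n)) (+-identityʳ _)

  ⊛-identityˡ : ∀ f → constant 1# ⊛ f ≋ f
  ⊛-identityˡ f n = trans (⊛-constantˡ 1# f n) (*-identityˡ _)

  shift-⊛ : ∀ f g → shift f ⊛ g ≋ shift (f ⊛ g)
  shift-⊛ f g zero    = zeroˡ _
  shift-⊛ f g (suc n) = trans (+-congʳ (zeroˡ _)) (+-identityˡ _)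

  ⊛-as-∑ : ∀ f g n → (f ⊛ g) n ≈ ∑< (suc n) (λ i → f i * g (n ℕ.∸ i))
  ⊛-as-∑ f g zero    = sym (+-identityʳ _)
  ⊛-as-∑ f g (suc n) = +-congˡ (⊛-as-∑ (f ∘ suc) g n)

  shift-cong : ∀ {f g} → f ≋ g → shift f ≋ shift g
  shift-cong p zero    = refl
  shift-cong p (suc n) = p n

  -- Used at two nested levels: over the integers it gives the series in q, and over those the
  -- series in t.
  seriesRing : CommutativeRing c ℓ
  seriesRing = record
    { Carrier = Series
    ; _≈_     = _≋_
    ; _+_     = λ f g n → f n + g n
    ; _*_     = _⊛_
    ; -_      = λ f n → - f n
    ; 0#      = λ _ → 0#
    ; 1#      = constant 1#
    ; isCommutativeRing = record
      { isRing = record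
        { +-isAbelianGroup = record
          { isGroup = record
            { isMonoid = record
              { isSemigroup = record
                { isMagma = record
                  { isEquivalence = record
                    { refl  = λ _ → refl
                    ; sym   = λ p n → sym (p n)
                    ; trans = λ p r n → trans (p n) (r n)
                    }
                  ; ∙-cong = λ p r n → +-cong (p n) (r n)
                  }
                ; assoc = λ f g h n → +-assoc _ _ _
                }
              ; identity = (λ f n → +-identityˡ _) , (λ f n → +-identityʳ _)
              }
            ; inverse = (λ f n → -‿inverseˡ _) , (λ f n → -‿inverseʳ _)
            ; ⁻¹-cong = λ p n → -‿cong (p n)
            }
          ; comm = λ f g n → +-comm _ _
          }
        ; *-cong     = ⊛-cong
        ; *-assoc    = ⊛-assoc
        ; *-identity = ⊛-identityˡ , λ f n → trans (⊛-comm f (constant 1#) n) (⊛-identityˡ f n)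
        ; distrib    = (λ f g h n → trans (⊛-comm f _ n)
                          (trans (⊛-distribʳ f g h n) (+-cong (⊛-comm g f n) (⊛-comm h f n))))
                     , ⊛-distribʳ
        }
      ; *-comm = ⊛-comm
      }
    }

-- Words, contents and descents

≡ᵇ-true : ∀ m n → (m ≡ᵇ n) ≡ true → m ≡ n
≡ᵇ-true m n p = ℕₚ.≡ᵇ⇒≡ m n (≡.subst Bool.T (≡.sym p) tt)

-- The index `c` stands for the letter `suc c`; `nothing` means that no word of content `η` begins
-- with it. An exhausted letter keeps its entry 0, so the alphabet never shrinks.
decAt : ℕ → List ℕ → Maybe (List ℕ)
decAt c       []          = nothing
decAt zero    (zero ∷ η)  = nothing
decAt zero    (suc m ∷ η) = just (m ∷ η)
decAt (suc c) (e ∷ η)     = Maybe.map (e ∷_) (decAt c η)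

decAt-length : ∀ c η {η′} → decAt c η ≡ just η′ → length η′ ≡ length η
decAt-length zero    (suc m ∷ η) ≡.refl = ≡.refl
decAt-length (suc c) (e ∷ η)     p with decAt c η in eq
decAt-length (suc c) (e ∷ η) ≡.refl | just _ = ≡.cong suc (decAt-length c η eq)

decAt-sum : ∀ c η {η′} → decAt c η ≡ just η′ → suc (sum η′) ≡ sum η
decAt-sum zero    (suc m ∷ η) ≡.refl = ≡.refl
decAt-sum (suc c) (e ∷ η)     p with decAt c η in eq
decAt-sum (suc c) (e ∷ η) ≡.refl | just _ =
  ≡.trans (≡.sym (ℕₚ.+-suc e _)) (≡.cong (e ℕ.+_) (decAt-sum c η eq))

content : ℕ → List ℕ → List ℕ
content r w = applyUpTo (λ j → occ (suc j) w) r

-- The function on the left is what `content` computes once `suc c` is put in front of a word.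
-- Charging that letter to `η` instead turns recursion on words into recursion on multisets.
eqListℕ-increment : ∀ (f : ℕ → ℕ) c r η → c ℕ.< r →
  eqListℕ (applyUpTo (λ j → if c ≡ᵇ j then suc (f j) else f j) r) η
    ≡ maybe (eqListℕ (applyUpTo f r)) false (decAt c η)
eqListℕ-increment f zero    (suc r) []          _ = ≡.refl
eqListℕ-increment f (suc c) (suc r) []          _ = ≡.refl
eqListℕ-increment f zero    (suc r) (zero ∷ η)  _ = ≡.refl
eqListℕ-increment f zero    (suc r) (suc m ∷ η) _ = ≡.refl
eqListℕ-increment f (suc c) (suc r) (e ∷ η) (ℕ.s<s c<r)
  rewrite eqListℕ-increment (f ∘ suc) c r η c<r with decAt c η
... | just η′ = ≡.refl
... | nothing with f 0 ≡ᵇ e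
...   | true  = ≡.refl
...   | false = ≡.refl

content-zero : ∀ η → sum η ≡ 0 → eqListℕ (content (length η) []) η ≡ true
content-zero []         _ = ≡.refl
content-zero (zero ∷ η) p = content-zero η p

-- descent s s′ b decides whether a letter of sign s followed by one of sign s′ is a descent,
-- b telling whether the second letter is smaller than the first in absolute value.
descent : Bool → Bool → Bool → Bool
descent true  true  b = b
descent true  false b = true
descent false true  b = false
descent false false b = not b

-- Descents read off the letters alone; the previous letter has sign s and absolute value i + 1.
-- A word starts with s = true and i = 0: like std₀ = 0, the letter 1 is a descent exactly
-- before negative letters.
localDes : ℕ → Bool → ℕ → List ℕ → List Bool → List ℕ
localDes j s i (c ∷ w) (s′ ∷ e) =
  if descent s s′ (c ∸ 1 <ᵇ i) then j ∷ localDes (suc j) s′ (c ∸ 1) w e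
  else localDes (suc j) s′ (c ∸ 1) w e
localDes j s i _ _ = []

localDes-suc : ∀ j s i w e → localDes (suc j) s i w e ≡ map suc (localDes j s i w e)
localDes-suc j s i []      e       = ≡.refl
localDes-suc j s i (c ∷ w) []      = ≡.refl
localDes-suc j s i (c ∷ w) (s′ ∷ e) with descent s s′ (c ∸ 1 <ᵇ i)
... | true  = ≡.cong (suc j ∷_) (localDes-suc (suc j) s′ (c ∸ 1) w e)
... | false = localDes-suc (suc j) s′ (c ∸ 1) w e

sum-map-suc : ∀ xs → sum (map suc xs) ≡ length xs ℕ.+ sum xs
sum-map-suc []       = ≡.refl
sum-map-suc (x ∷ xs) = ≡.cong suc (≡.trans (≡.cong (x ℕ.+_) (sum-map-suc xs)) lem)
  where
  lem : x ℕ.+ (length xs ℕ.+ sum xs) ≡ length xs ℕ.+ (x ℕ.+ sum xs)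
  lem = ≡.trans (≡.sym (ℕₚ.+-assoc x _ _))
          (≡.trans (≡.cong (ℕ._+ sum xs) (ℕₚ.+-comm x _)) (ℕₚ.+-assoc (length xs) x _))

tri : ℕ → ℕ
tri j = (j ℕ.* (j ∸ 1)) / 2

tri-suc : ∀ j → tri (suc j) ≡ j ℕ.+ tri j
tri-suc zero    = ≡.refl
tri-suc (suc j) = ≡.trans (≡.cong (_/ 2) (double j))
  (≡.trans (+-distrib-/-∣ˡ (suc j ℕ.* j) (n∣m*n (suc j)))
    (≡.cong (ℕ._+ tri (suc j)) (m*n/n≡m (suc j) 2)))
  where
  double : ∀ j → suc (suc j) ℕ.* suc j ≡ suc j ℕ.* 2 ℕ.+ suc j ℕ.* j
  double = solve-∀

+suc-+suc : ∀ i K → + suc i ℤ.- + suc K ≡ + i ℤ.- + K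
+suc-+suc i K = ≡.trans (ℤₚ.m-n≡m⊖n (suc i) (suc K))
  (≡.trans (ℤₚ.[1+m]⊖[1+n]≡m⊖n i K) (≡.sym (ℤₚ.m-n≡m⊖n i K)))

∣top-K∣ : ∀ K → ∣ + suc (K ℕ.+ K) ℤ.- + K ∣ ≡ suc K
∣top-K∣ K = ≡.trans (≡.cong ∣_∣ (≡.trans (ℤₚ.m-n≡m⊖n (suc (K ℕ.+ K)) K)
  (ℤₚ.⊖-≥ (ℕₚ.m≤n⇒m≤1+n (ℕₚ.m≤m+n K K)))))
  (ℕₚ.m+n∸n≡m (suc K) K)

-- The recurrences, over a ring with powers of q

module Telescoping {c ℓ : Level} (R : CommutativeRing c ℓ) where
  open CommutativeRing R hiding (zero)
  open FiniteSums R
  open SetoidReasoning setoid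
  open import Algebra.Solver.Ring.NaturalCoefficients.Default commutativeSemiring
    using (solve; _:+_; _:=_)

  private
    rotate : ∀ a b c → (a + b) + c ≈ a + (c + b)
    rotate = solve 3 (λ a b c → (a :+ b) :+ c := a :+ (c :+ b)) refl

  module _ (F G : ℕ → Carrier) where
    -- Here `c` runs through the letters of one sign, and `G c` is picked up on passing a letter.
    -- The four sums below keep the full range and cut it with an `if`, so that sums for the two
    -- signs can be merged letter by letter.
    Falls Rises : ℕ → Set ℓ
    Falls n = ∀ c → c ℕ.< n → F c ≈ F (suc c) + G c
    Rises n = ∀ c → c ℕ.< n → F (suc c) ≈ F c + G c

  falls-from : ∀ i n {F G} → i ℕ.≤ n → Falls F G n →
    F i ≈ F n + ∑< n (λ c → if c <ᵇ i then 0# else G c)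
  falls-from zero    zero    _ h = sym (+-identityʳ _)
  falls-from zero    (suc n) _ h = begin
    _ ≈⟨ h 0 ℕ.z<s ⟩
    _ ≈⟨ +-congʳ (falls-from zero n ℕ.z≤n (λ c c<n → h (suc c) (ℕ.s<s c<n))) ⟩
    _ ≈⟨ rotate _ _ _ ⟩
    _ ∎
  falls-from (suc i) (suc n) (ℕ.s≤s i≤n) h =
    trans (falls-from i n i≤n (λ c c<n → h (suc c) (ℕ.s<s c<n))) (+-congˡ (sym (+-identityˡ _)))

  falls-to : ∀ i n {F G} → i ℕ.≤ n → Falls F G n →
    F 0 ≈ F i + ∑< n (λ c → if c <ᵇ i then G c else 0#)
  falls-to zero    n       _ h = sym (trans (+-congˡ (∑<-zero n)) (+-identityʳ _))
  falls-to (suc i) (suc n) (ℕ.s≤s i≤n) h = begin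
    _ ≈⟨ h 0 ℕ.z<s ⟩
    _ ≈⟨ +-congʳ (falls-to i n i≤n (λ c c<n → h (suc c) (ℕ.s<s c<n))) ⟩
    _ ≈⟨ rotate _ _ _ ⟩
    _ ∎

  rises-from : ∀ i n {F G} → i ℕ.≤ n → Rises F G n →
    F n ≈ F i + ∑< n (λ c → if c <ᵇ i then 0# else G c)
  rises-from zero    zero    _ h = sym (+-identityʳ _)
  rises-from zero    (suc n) _ h = begin
    _ ≈⟨ rises-from zero n ℕ.z≤n (λ c c<n → h (suc c) (ℕ.s<s c<n)) ⟩
    _ ≈⟨ +-congʳ (h 0 ℕ.z<s) ⟩
    _ ≈⟨ +-assoc _ _ _ ⟩
    _ ∎
  rises-from (suc i) (suc n) (ℕ.s≤s i≤n) h =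
    trans (rises-from i n i≤n (λ c c<n → h (suc c) (ℕ.s<s c<n))) (+-congˡ (sym (+-identityˡ _)))

  rises-to : ∀ i n {F G} → i ℕ.≤ n → Rises F G n →
    F i ≈ F 0 + ∑< n (λ c → if c <ᵇ i then G c else 0#)
  rises-to zero    n       _ h = sym (trans (+-congˡ (∑<-zero n)) (+-identityʳ _))
  rises-to (suc i) (suc n) (ℕ.s≤s i≤n) h = begin
    _ ≈⟨ rises-to i n i≤n (λ c c<n → h (suc c) (ℕ.s<s c<n)) ⟩
    _ ≈⟨ +-congʳ (h 0 ℕ.z<s) ⟩
    _ ≈⟨ +-assoc _ _ _ ⟩
    _ ∎

module QSeries {c ℓ : Level} (R : CommutativeRing c ℓ)
  (q^ : ℕ → CommutativeRing.Carrier R)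
  (q^-zero : CommutativeRing._≈_ R (q^ 0) (CommutativeRing.1# R))
  (q^-+ : ∀ a b → CommutativeRing._≈_ R (q^ (a ℕ.+ b)) (CommutativeRing._*_ R (q^ a) (q^ b)))
  where
  open CommutativeRing R hiding (zero)
  open FiniteSums R
  open PowerSeries R
  open Telescoping R
  open SetoidReasoning setoid
  module S = CommutativeRing seriesRing
  module ∑S = FiniteSums seriesRing
  open import Algebra.Solver.Ring.NaturalCoefficients.Default commutativeSemiring
    using (solve; con; _:+_; _:*_; _:=_)
  open import Algebra.Properties.Ring (CommutativeRing.ring R) using (-‿distribˡ-*; -‿distribʳ-*)

  -- f(t) ↦ f(qt)
  dilate : Series → Series
  dilate f k = q^ k * f k

  dilate-cong : ∀ {f g} → f ≋ g → dilate f ≋ dilate g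
  dilate-cong p k = *-congˡ (p k)

  dilate-⊛ : ∀ f g → dilate f ⊛ dilate g ≋ dilate (f ⊛ g)
  dilate-⊛ f g zero    = begin
    q^ 0 * f 0 * (q^ 0 * g 0)   ≈⟨ *-congʳ (trans (*-congʳ q^-zero) (*-identityˡ _)) ⟩
    f 0 * (q^ 0 * g 0)
      ≈⟨ solve 3 (λ a b c → a :* (b :* c) := b :* (a :* c)) refl _ _ _ ⟩
    q^ 0 * (f 0 * g 0)          ∎
  dilate-⊛ f g (suc n) = begin
    q^ 0 * f 0 * (q^ (suc n) * g (suc n)) + ((dilate f ∘ suc) ⊛ dilate g) n
      ≈⟨ +-cong (*-congʳ (trans (*-congʳ q^-zero) (*-identityˡ _)))
                (⊛-cong (λ k → trans (*-congʳ (q^-+ 1 k)) (*-assoc _ _ _)) (λ _ → refl) n) ⟩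
    f 0 * (q^ (suc n) * g (suc n)) + ((λ k → q^ 1 * dilate (f ∘ suc) k) ⊛ dilate g) n
      ≈⟨ +-congˡ (⊛-scaleˡ (q^ 1) (dilate (f ∘ suc)) (dilate g) n) ⟩
    f 0 * (q^ (suc n) * g (suc n)) + q^ 1 * (dilate (f ∘ suc) ⊛ dilate g) n
      ≈⟨ +-congˡ (*-congˡ (dilate-⊛ (f ∘ suc) g n)) ⟩
    f 0 * (q^ (suc n) * g (suc n)) + q^ 1 * (q^ n * ((f ∘ suc) ⊛ g) n)
      ≈⟨ +-congˡ (trans (sym (*-assoc _ _ _)) (*-congʳ (sym (q^-+ 1 n)))) ⟩
    f 0 * (q^ (suc n) * g (suc n)) + q^ (suc n) * ((f ∘ suc) ⊛ g) n
      ≈⟨ solve 4 (λ a b c d → a :* (b :* c) :+ b :* d := b :* (a :* c :+ d)) refl _ _ _ _ ⟩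
    q^ (suc n) * (f 0 * g (suc n) + ((f ∘ suc) ⊛ g) n) ∎

  -- (T f)(k) = Σ_{|z| ≤ k} q^(k−|z|) f(k−|z|)
  T : (ℕ → Carrier) → ℕ → Carrier
  T f zero    = q^ 0 * f 0
  T f (suc k) = (T f k + q^ k * f k) + q^ (suc k) * f (suc k)

  -- E m k is the weighted number of lattice points of k ◇_m; equivalently, of multisets of
  -- size m in {0, …, k}, each distinct value below k being optionally marked.
  E : ℕ → ℕ → Carrier
  E zero    k = 1#
  E (suc m) k = T (E m) k

  -- Counting letter by letter: the factors and their products

  atPred : (ℕ → Carrier) → ℕ → Carrier
  atPred Q zero    = 0#
  atPred Q (suc m) = Q m

  -- Marked copies will be the negative letters. In `pos` the value k is never marked; the second
  -- term of `full` takes out one marked copy of value k. All values counted by `none (suc k)` are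
  -- at most k, and k may be marked there, whence `full k`.
  pos full none : ℕ → ℕ → Carrier
  pos  k m = E m k
  full k m = pos k m + q^ k * atPred (pos k) m
  none zero    zero    = 1#
  none zero    (suc m) = 0#
  none (suc k) m       = full k m

  -- Either no copy carries the value k, or one unmarked copy carrying it can be removed. Away from
  -- the boundary this is literally the recurrence defining `T`.
  pos≈none : ∀ k m → pos k m ≈ none k m + q^ k * atPred (pos k) m
  pos≈none zero    zero    = sym (trans (+-congˡ (zeroʳ _)) (+-identityʳ _))
  pos≈none zero    (suc m) = sym (+-identityˡ _)
  pos≈none (suc k) zero    =
    sym (trans (+-cong (trans (+-congˡ (zeroʳ _)) (+-identityʳ _)) (zeroʳ _)) (+-identityʳ _))
  pos≈none (suc k) (suc m) = refl

  full-zero : ∀ k → full k 0 ≈ 1#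
  full-zero k = trans (+-congˡ (zeroʳ _)) (+-identityʳ _)

  none-zero : ∀ k → none k 0 ≈ 1#
  none-zero zero    = refl
  none-zero (suc k) = full-zero k

  mixedProduct : (P Q : ℕ → Carrier) → ℕ → List ℕ → Carrier
  mixedProduct P Q i       []      = 1#
  mixedProduct P Q zero    (e ∷ η) = Q e * mixedProduct P Q zero η
  mixedProduct P Q (suc i) (e ∷ η) = P e * mixedProduct P Q i η

  mixedProduct-zero : ∀ P P′ Q η → mixedProduct P Q 0 η ≈ mixedProduct P′ Q 0 η
  mixedProduct-zero P P′ Q []      = refl
  mixedProduct-zero P P′ Q (e ∷ η) = *-congˡ (mixedProduct-zero P P′ Q η)

  mixedProduct-length : ∀ P Q Q′ η →
    mixedProduct P Q (length η) η ≈ mixedProduct P Q′ (length η) η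
  mixedProduct-length P Q Q′ []      = refl
  mixedProduct-length P Q Q′ (e ∷ η) = *-congˡ (mixedProduct-length P Q Q′ η)

  mixedProduct-one : ∀ {P Q} i η → P 0 ≈ 1# → Q 0 ≈ 1# → sum η ≡ 0 → mixedProduct P Q i η ≈ 1#
  mixedProduct-one i       []         p r z = refl
  mixedProduct-one zero    (zero ∷ η) p r z =
    trans (*-cong r (mixedProduct-one zero η p r z)) (*-identityˡ _)
  mixedProduct-one (suc i) (zero ∷ η) p r z =
    trans (*-cong p (mixedProduct-one i η p r z)) (*-identityˡ _)

  -- There is no value below 0, so a single nonzero multiplicity kills the product.
  mixedProduct-none : ∀ Q η → sum η ≢ 0 → mixedProduct (none 0) Q (length η) η ≈ 0#
  mixedProduct-none Q []          z with () ← z ≡.refl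
  mixedProduct-none Q (zero ∷ η)  z = trans (*-congˡ (mixedProduct-none Q η z)) (zeroʳ _)
  mixedProduct-none Q (suc m ∷ η) z = zeroˡ _

  -- Only the factor of the letter `c` changes between the two cuts, and the hypothesis on `P` and
  -- `Q` turns that change into the same product with one copy of the letter spent.
  mixedProduct-suc : ∀ {P Q} u → (∀ m → P m ≈ Q m + u * atPred Q m) →
    ∀ c η → c ℕ.< length η →
    mixedProduct P Q (suc c) η
      ≈ mixedProduct P Q c η + u * maybe (mixedProduct P Q c) 0# (decAt c η)
  mixedProduct-suc {P} {Q} u h zero (zero ∷ η) _ = begin
    P 0 * X                ≈⟨ *-congʳ (h 0) ⟩
    (Q 0 + u * 0#) * X
      ≈⟨ solve 3 (λ a b u → (a :+ u :* con 0) :* b := a :* b :+ u :* con 0) refl _ _ _ ⟩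
    Q 0 * X + u * 0#       ∎
    where X = mixedProduct P Q 0 η
  mixedProduct-suc {P} {Q} u h zero (suc m ∷ η) _ = begin
    P (suc m) * X              ≈⟨ *-congʳ (h (suc m)) ⟩
    (Q (suc m) + u * Q m) * X
      ≈⟨ solve 4 (λ a b u x → (a :+ u :* b) :* x := a :* x :+ u :* (b :* x)) refl _ _ _ _ ⟩
    Q (suc m) * X + u * (Q m * X) ∎
    where X = mixedProduct P Q 0 η
  mixedProduct-suc {P} {Q} u h (suc c) (e ∷ η) (ℕ.s<s c<r) =
    trans (*-congˡ (mixedProduct-suc u h c η c<r)) (lem (decAt c η))
    where
    lem : ∀ d → P e * (mixedProduct P Q c η + u * maybe (mixedProduct P Q c) 0# d)
              ≈ P e * mixedProduct P Q c η
                + u * maybe (mixedProduct P Q (suc c)) 0# (Maybe.map (e ∷_) d)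
    lem (just η′) = solve 4 (λ a b u x → a :* (b :+ u :* x) := a :* b :+ u :* (a :* x)) refl _ _ _ _
    lem nothing   = solve 3 (λ a b u → a :* (b :+ u :* con 0) := a :* b :+ u :* con 0) refl _ _ _

  -- The words that may follow a letter of sign s and absolute value i + 1, each carrying a
  -- sequence k ≥ a₁ ≥ a₂ ≥ … that is strict at the descents, are counted letter by letter:
  -- copies of a letter carrying the value k may be positive or negative (full), only
  -- positive (pos) or are forbidden (none).
  N : Bool → ℕ → List ℕ → ℕ → Carrier
  N true  i η k = mixedProduct (none k) (pos k) i η
  N false i η k = mixedProduct (full k) (pos k) i η

  N-zero : ∀ s i η k → sum η ≡ 0 → N s i η k ≈ 1#
  N-zero true  i η k = mixedProduct-one i η (none-zero k) refl
  N-zero false i η k = mixedProduct-one i η (full-zero k) refl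

  -- the remaining count once the letter of sign s and absolute value c + 1 carries the value k
  G : List ℕ → Bool → ℕ → ℕ → Carrier
  G η s c k = q^ k * maybe (λ η′ → N s c η′ k) 0# (decAt c η)

  N-falls : ∀ η k → Falls (λ c → N true c η k) (λ c → G η true c k) (length η)
  N-falls η k c c<r = begin
    F c                                 ≈⟨ +-identityʳ _ ⟨
    F c + 0#                            ≈⟨ +-congˡ (-‿inverseˡ _) ⟨
    F c + (- (q^ k * X) + q^ k * X)     ≈⟨ +-assoc _ _ _ ⟨
    (F c + - (q^ k * X)) + q^ k * X     ≈⟨ +-congʳ (+-congˡ (-‿distribˡ-* _ _)) ⟩
    (F c + - q^ k * X) + q^ k * X       ≈⟨ +-congʳ (mixedProduct-suc (- q^ k) h c η c<r) ⟨
    F (suc c) + q^ k * X                ∎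
    where
    F : ℕ → Carrier
    F c = N true c η k
    X = maybe (mixedProduct (none k) (pos k) c) 0# (decAt c η)
    -- `mixedProduct-suc` needs `none k` in terms of `pos k`; solving `pos≈none` for it makes the
    -- weight negative, which is why this sequence falls.
    h : ∀ m → none k m ≈ pos k m + - q^ k * atPred (pos k) m
    h m = begin
      none k m                              ≈⟨ +-identityʳ _ ⟨
      none k m + 0#                         ≈⟨ +-congˡ (-‿inverseʳ _) ⟨
      none k m + (Y + - Y)                  ≈⟨ +-assoc _ _ _ ⟨
      (none k m + Y) + - Y                  ≈⟨ +-cong (sym (pos≈none k m)) (-‿distribˡ-* _ _) ⟩
      pos k m + - q^ k * atPred (pos k) m   ∎
      where Y = q^ k * atPred (pos k) m

  N-rises : ∀ η k → Rises (λ c → N false c η k) (λ c → G η false c k) (length η)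
  N-rises η k c c<r = mixedProduct-suc (q^ k) (λ m → refl) c η c<r

  -- With the cut at 0 only factors `pos k` remain, whatever the sign. In the order -r < ... < -1 <
  -- 1 < ... < r this glues the telescope over the negative letters to the one over the positive
  -- letters.
  N-sign : ∀ η k → N false 0 η k ≈ N true 0 η k
  N-sign η k = mixedProduct-zero _ _ _ η

  -- The first-letter recurrence for `N`

  ∑± : (Bool → Carrier) → Carrier
  ∑± f = f true + f false

  weakSteps strictSteps : List ℕ → Bool → ℕ → ℕ → Carrier
  weakSteps   η s i k = ∑< (length η) λ c → ∑± λ s′ →
    if descent s s′ (c <ᵇ i) then 0# else G η s′ c k
  strictSteps η s i k = ∑< (length η) λ c → ∑± λ s′ →
    if descent s s′ (c <ᵇ i) then G η s′ c k else 0#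

  if-not : ∀ b {x y : Carrier} → (if not b then x else y) ≈ (if b then y else x)
  if-not true  = refl
  if-not false = refl

  -- Telescope from the previous letter up to the top of the order of signed letters: the letters
  -- passed are those that can carry the value k next without a descent. The cut `length η` at the
  -- top leaves only factors `none k`, so nothing carries k.
  N-weak : ∀ η s i k → i ℕ.≤ length η →
    N s i η k ≈ N true (length η) η k + weakSteps η s i k
  N-weak η true i k i≤r =
    trans (falls-from i (length η) i≤r (N-falls η k))
          (+-congˡ (∑<-cong (length η) (λ c _ → sym (+-identityʳ _))))
  N-weak η false i k i≤r = begin
    N false i η k
      ≈⟨ rises-to i r i≤r (N-rises η k) ⟩
    N false 0 η k + A
      ≈⟨ +-congʳ (trans (N-sign η k) (falls-from 0 r ℕ.z≤n (N-falls η k))) ⟩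
    (N true r η k + B) + A
      ≈⟨ +-assoc _ _ _ ⟩
    N true r η k + (B + A)
      ≈⟨ +-congˡ (trans (sym (∑<-+ r _ _))
           (∑<-cong r (λ c _ → +-congˡ (sym (if-not (c <ᵇ i)))))) ⟩
    N true r η k + weakSteps η false i k ∎
    where
    r = length η
    A = ∑< r (λ c → if c <ᵇ i then G η false c k else 0#)
    B = ∑< r (λ c → G η true c k)

  -- The complementary walk, from the bottom of the order, where every factor is `full k`, up to the
  -- previous letter; the letters passed are exactly those that create a descent.
  N-strict : ∀ η s i k → i ℕ.≤ length η →
    N false (length η) η k ≈ N s i η k + strictSteps η s i k
  N-strict η true i k i≤r = begin
    N false r η k
      ≈⟨ rises-from 0 r ℕ.z≤n (N-rises η k) ⟩
    N false 0 η k + B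
      ≈⟨ +-congʳ (trans (N-sign η k) (falls-to i r i≤r (N-falls η k))) ⟩
    (N true i η k + A) + B
      ≈⟨ +-assoc _ _ _ ⟩
    N true i η k + (A + B)
      ≈⟨ +-congˡ (sym (∑<-+ r _ _)) ⟩
    N true i η k + strictSteps η true i k ∎
    where
    r = length η
    A = ∑< r (λ c → if c <ᵇ i then G η true c k else 0#)
    B = ∑< r (λ c → G η false c k)
  N-strict η false i k i≤r =
    trans (rises-from i (length η) i≤r (N-rises η k))
      (+-congˡ (∑<-cong (length η) (λ c _ →
        trans (sym (if-not (c <ᵇ i))) (sym (+-identityˡ _)))))

  delayed : Bool → Series → Series
  delayed b f = if b then shift f else f

  -- The operator sending f to Σ_y t^[y is a descent] f_y(qt), over the possible next letters y. It
  -- governs both the counts `N` and the descent polynomials, which is what makes them comparable.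
  transfer : ℕ → Bool → ℕ → (Bool → ℕ → Series) → Series
  transfer r s i f k = ∑< r λ c → ∑± λ s′ → delayed (descent s s′ (c <ᵇ i)) (dilate (f s′ c)) k

  maybeN : List ℕ → Bool → ℕ → Series
  maybeN η s c k = maybe (λ η′ → N s c η′ k) 0# (decAt c η)

  N-recurrence : ∀ η s i → sum η ≢ 0 → i ℕ.≤ length η → ∀ k →
    N s i η k ≈ shift (N s i η) k + transfer (length η) s i (maybeN η) k
  N-recurrence η s i η≢0 i≤r zero = begin
    N s i η 0
      ≈⟨ N-weak η s i 0 i≤r ⟩
    N true r η 0 + weakSteps η s i 0
      -- At k = 0 some letter has to carry the value 0, since `η` is not exhausted; strict steps are
      -- delayed and contribute nothing yet.
      ≈⟨ +-cong (mixedProduct-none _ η η≢0)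
                (∑<-cong r (λ c _ → +-cong (lem (descent s true (c <ᵇ i)))
                                           (lem (descent s false (c <ᵇ i))))) ⟩
    0# + transfer r s i (maybeN η) 0 ∎
    where
    r = length η
    lem : ∀ b {f} → (if b then 0# else f 0) ≈ delayed b f 0
    lem true  = refl
    lem false = refl
  N-recurrence η s i η≢0 i≤r (suc k) = begin
    N s i η (suc k)
      ≈⟨ N-weak η s i (suc k) i≤r ⟩
    N true r η (suc k) + weakSteps η s i (suc k)
      -- Since `none (suc k)` is `full k` by definition, the top of the walk at k + 1 is the bottom
      -- of the walk at k. The strict steps thus enter one degree late, as the factor t demands.
      ≈⟨ +-congʳ (trans (mixedProduct-length (full k) _ _ η) (N-strict η s i k i≤r)) ⟩
    (N s i η k + strictSteps η s i k) + weakSteps η s i (suc k)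
      ≈⟨ +-assoc _ _ _ ⟩
    N s i η k + (strictSteps η s i k + weakSteps η s i (suc k))
      ≈⟨ +-congˡ (trans (sym (∑<-+ r _ _)) (∑<-cong r (λ c _ →
           trans (interchange _ _ _ _)
             (+-cong (lem (descent s true (c <ᵇ i))) (lem (descent s false (c <ᵇ i))))))) ⟩
    N s i η k + transfer r s i (maybeN η) (suc k) ∎
    where
    r = length η
    lem : ∀ b {f} → (if b then f k else 0#) + (if b then 0# else f (suc k)) ≈ delayed b f (suc k)
    lem true  = +-identityʳ _
    lem false = +-identityˡ _

  ∑S-coeff : ∀ {A : Set} (xs : List A) (f : A → Series) k → ∑S.∑ xs f k ≈ ∑ xs (λ x → f x k)
  ∑S-coeff []       f k = refl
  ∑S-coeff (x ∷ xs) f k = +-congˡ (∑S-coeff xs f k)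

  ∑<S-coeff : ∀ n (f : ℕ → Series) k → ∑S.∑< n f k ≈ ∑< n (λ i → f i k)
  ∑<S-coeff zero    f k = refl
  ∑<S-coeff (suc n) f k = +-congˡ (∑<S-coeff n (f ∘ suc) k)

  -- The denominator

  oneMinus : ℕ → Series
  oneMinus i zero          = 1#
  oneMinus i (suc zero)    = - q^ i
  oneMinus i (suc (suc _)) = 0#

  denominator : ℕ → Series
  denominator zero    = oneMinus 0
  denominator (suc n) = denominator n ⊛ oneMinus (suc n)

  oneMinus-dilate : ∀ i → oneMinus (suc i) ≋ dilate (oneMinus i)
  oneMinus-dilate i zero          = sym (trans (*-congʳ q^-zero) (*-identityˡ _))
  oneMinus-dilate i (suc zero)    = trans (-‿cong (q^-+ 1 i)) (-‿distribʳ-* _ _)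
  oneMinus-dilate i (suc (suc k)) = sym (zeroʳ _)

  -- Replacing t by qt raises every index by one, and the factor 1 - t left over is the one that
  -- will absorb the term t N(t).
  denominator-dilate : ∀ n → denominator (suc n) ≋ oneMinus 0 ⊛ dilate (denominator n)
  denominator-dilate zero    = ⊛-cong (λ _ → refl) (oneMinus-dilate 0)
  denominator-dilate (suc n) = S.trans
    (⊛-cong (denominator-dilate n) (oneMinus-dilate (suc n)))
    (S.trans (⊛-assoc (oneMinus 0) _ _)
             (⊛-cong (λ _ → refl) (dilate-⊛ (denominator n) (oneMinus (suc n)))))

  oneMinus-⊛ : ∀ f g → (∀ k → f k ≈ shift f k + g k) → oneMinus 0 ⊛ f ≋ g
  oneMinus-⊛ f g h zero    = trans (*-identityˡ _) (trans (h 0) (+-identityˡ _))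
  oneMinus-⊛ f g h (suc n) = begin
    1# * f (suc n) + ((oneMinus 0 ∘ suc) ⊛ f) n
      ≈⟨ +-cong (*-identityˡ _) (⊛-cong tail (λ _ → refl) n) ⟩
    f (suc n) + (constant (- 1#) ⊛ f) n
      ≈⟨ +-cong (h (suc n)) (⊛-constantˡ (- 1#) f n) ⟩
    (f n + g (suc n)) + - 1# * f n
      ≈⟨ +-cong (+-comm _ _) (trans (sym (-‿distribˡ-* _ _)) (-‿cong (*-identityˡ _))) ⟩
    (g (suc n) + f n) + - f n
      ≈⟨ trans (+-assoc _ _ _) (+-congˡ (-‿inverseʳ _)) ⟩
    g (suc n) + 0#
      ≈⟨ +-identityʳ _ ⟩
    g (suc n) ∎
    where
    tail : (oneMinus 0 ∘ suc) ≋ constant (- 1#)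
    tail zero    = -‿cong q^-zero
    tail (suc k) = refl

  delayed-cong : ∀ b {f g} → f ≋ g → delayed b f ≋ delayed b g
  delayed-cong true  p = shift-cong p
  delayed-cong false p = p

  delayed-⊛ : ∀ b h f → h ⊛ delayed b f ≋ delayed b (h ⊛ f)
  delayed-⊛ false h f = λ _ → refl
  delayed-⊛ true  h f = S.trans (⊛-comm h (shift f))
    (S.trans (shift-⊛ f h) (shift-cong (⊛-comm f h)))

  delayed-0 : ∀ b → delayed b (λ _ → 0#) ≋ λ _ → 0#
  delayed-0 true  zero    = refl
  delayed-0 true  (suc k) = refl
  delayed-0 false k       = refl

  delayed-+ : ∀ b f g → delayed b (λ k → f k + g k) ≋ λ k → delayed b f k + delayed b g k
  delayed-+ true  f g zero    = sym (+-identityˡ _)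
  delayed-+ true  f g (suc k) = refl
  delayed-+ false f g k       = refl

  delayed-dilate-∑ : ∀ {A : Set} b (xs : List A) (f : A → Series) →
    ∑S.∑ xs (λ x → delayed b (dilate (f x))) ≋ delayed b (dilate (∑S.∑ xs f))
  delayed-dilate-∑ b []       f =
    S.sym (S.trans (delayed-cong b (λ _ → zeroʳ _)) (delayed-0 b))
  delayed-dilate-∑ b (x ∷ xs) f =
    S.trans (λ k → +-congˡ (delayed-dilate-∑ b xs f k))
      (S.sym (S.trans (delayed-cong b (λ k → distribˡ (q^ k) _ _)) (delayed-+ b _ _)))

  transfer-cong : ∀ r s i {f g} → (∀ s′ c → c ℕ.< r → f s′ c ≋ g s′ c) →
    transfer r s i f ≋ transfer r s i g
  transfer-cong r s i h k = ∑<-cong r λ c c<r →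
    +-cong (delayed-cong (descent s true (c <ᵇ i)) (dilate-cong (h true c c<r)) k)
           (delayed-cong (descent s false (c <ᵇ i)) (dilate-cong (h false c c<r)) k)

  -- Delaying commutes with multiplication, and `dilate` is multiplicative, so a dilated factor
  -- passes undilated inside the operator.
  ⊛-transfer : ∀ r s i h f →
    dilate h ⊛ transfer r s i f ≋ transfer r s i (λ s′ c → h ⊛ f s′ c)
  ⊛-transfer r s i h f = S.trans
    (⊛-cong {f = dilate h} (λ _ → refl) (λ k → sym (∑<S-coeff r X k)))
    (S.trans (S.sym (∑S.∑<-*ˡ r (dilate h) X))
      (S.trans (∑S.∑<-cong r (λ c _ → S.trans (S.distribˡ (dilate h) _ _)
                  (S.+-cong (lem c true) (lem c false))))
               (∑<S-coeff r _)))
    where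
    X : ℕ → Series
    X c k = ∑± λ s′ → delayed (descent s s′ (c <ᵇ i)) (dilate (f s′ c)) k
    lem : ∀ c s′ → dilate h ⊛ delayed (descent s s′ (c <ᵇ i)) (dilate (f s′ c))
                 ≋ delayed (descent s s′ (c <ᵇ i)) (dilate (h ⊛ f s′ c))
    lem c s′ = S.trans (delayed-⊛ (descent s s′ (c <ᵇ i)) _ _)
                       (delayed-cong (descent s s′ (c <ᵇ i)) (dilate-⊛ h (f s′ c)))

  -- The descent polynomials

  monomial : List ℕ → Series
  monomial D k = if k ≡ᵇ length D then q^ (sum D) else 0#

  -- Moving all descents one position to the right adds des to maj, and that is the substitution of
  -- qt for t.
  monomial-map-suc : ∀ D → monomial (map suc D) ≋ dilate (monomial D)
  monomial-map-suc D k rewrite length-map suc D with k ≡ᵇ length D in eq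
  ... | false = sym (zeroʳ _)
  ... | true  rewrite ≡ᵇ-true k (length D) eq | sum-map-suc D =
    q^-+ (length D) (sum D)

  monomial-localDes : ∀ s i c w s′ e →
    monomial (localDes 0 s i (suc c ∷ w) (s′ ∷ e))
      ≋ delayed (descent s s′ (c <ᵇ i)) (dilate (monomial (localDes 0 s′ c w e)))
  monomial-localDes s i c w s′ e with descent s s′ (c <ᵇ i)
  ... | true = λ where
    zero    → refl
    (suc k) → trans (S.reflexive (≡.cong monomial (localDes-suc 0 s′ c w e)) k)
                    (monomial-map-suc (localDes 0 s′ c w e) k)
  ... | false = S.trans (S.reflexive (≡.cong monomial (localDes-suc 0 s′ c w e)))
                        (monomial-map-suc (localDes 0 s′ c w e))

  signSum : ℕ → Bool → ℕ → List ℕ → Series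
  signSum n s i w = ∑S.∑ (signs n) λ e → monomial (localDes 0 s i w e)

  -- The descent polynomial generalised to an arbitrary previous letter, so that the first letter
  -- can be split off.
  wordSum : ℕ → ℕ → Bool → ℕ → List ℕ → Series
  wordSum r n s i η = ∑S.∑ (words n r) λ w →
    if eqListℕ (content r w) η then signSum n s i w else λ _ → 0#

  signSum-step : ∀ n s i c w → signSum (suc n) s i (suc c ∷ w) ≋ λ k →
    ∑± λ s′ → delayed (descent s s′ (c <ᵇ i)) (dilate (signSum n s′ c w)) k
  signSum-step n s i c w = S.trans (∑S.∑-concatMap _ (signs n) _)
    (S.trans (∑S.∑-cong (signs n) (λ e → S.+-cong (monomial-localDes s i c w true e)
                 (S.trans (S.+-identityʳ _) (monomial-localDes s i c w false e))))
      (S.trans (∑S.∑-+ (signs n) _ _)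
        (S.+-cong (delayed-dilate-∑ (descent s true (c <ᵇ i)) (signs n) _)
                  (delayed-dilate-∑ (descent s false (c <ᵇ i)) (signs n) _))))

  maybeWordSum : ℕ → ℕ → List ℕ → Bool → ℕ → Series
  maybeWordSum r n η s c = maybe (wordSum r n s c) (λ _ → 0#) (decAt c η)

  wordSum-step : ∀ r n s i η →
    wordSum r (suc n) s i η ≋ transfer r s i (maybeWordSum r n η)
  wordSum-step r n s i η = S.trans (∑S.∑-concatMap _ (words n r) _)
    (S.trans (∑S.∑-cong (words n r) (λ w → ∑S.∑-applyUpTo (λ c → suc c ∷ w) r _))
      (S.trans (∑S.∑-∑< (words n r) r _)
        (S.trans (∑S.∑<-cong r perLetter) (∑<S-coeff r _))))
    where
    b : Bool → ℕ → Bool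
    b s′ c = descent s s′ (c <ᵇ i)

    guarded : ∀ c w g → Series
    guarded c w g = if g then signSum (suc n) s i (suc c ∷ w) else λ _ → 0#

    delayed-dilate-if : ∀ b g f → (if g then delayed b (dilate f) else (λ _ → 0#))
      ≋ delayed b (dilate (if g then f else (λ _ → 0#)))
    delayed-dilate-if b true  f = S.refl
    delayed-dilate-if b false f = S.sym (S.trans (delayed-cong b (λ _ → zeroʳ _)) (delayed-0 b))

    if-+ : ∀ g {x y f : Series} → f ≋ x S.+ y →
      (if g then f else (λ _ → 0#)) ≋
        (if g then x else (λ _ → 0#)) S.+ (if g then y else (λ _ → 0#))
    if-+ true  p = p
    if-+ false p = S.sym (S.+-identityˡ _)

    -- Stated for an arbitrary `d`, so that it can be split into cases independently of `decAt c η`.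
    perWord : ∀ c d → ∑S.∑ (words n r) (λ w → guarded c w (maybe (eqListℕ (content r w)) false d))
      ≋ λ k → ∑± λ s′ → delayed (b s′ c) (dilate (maybe (wordSum r n s′ c) (λ _ → 0#) d)) k
    perWord c nothing = S.trans (∑S.∑-zero (words n r))
      (S.trans (S.sym (S.+-identityˡ _))
        (S.+-cong (delayed-dilate-if (b true c) false S.0#)
                  (delayed-dilate-if (b false c) false S.0#)))
    perWord c (just η′) =
      S.trans (∑S.∑-cong (words n r) (λ w → S.trans
                 (if-+ (g w) (signSum-step n s i c w))
                 (S.+-cong (delayed-dilate-if (b true c) (g w) _)
                           (delayed-dilate-if (b false c) (g w) _))))
        (S.trans (∑S.∑-+ (words n r) _ _)
          (S.+-cong (delayed-dilate-∑ (b true c) (words n r) _)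
                    (delayed-dilate-∑ (b false c) (words n r) _)))
      where
      g : List ℕ → Bool
      g w = eqListℕ (content r w) η′

    perLetter : ∀ c → c ℕ.< r →
      ∑S.∑ (words n r) (λ w → guarded c w (eqListℕ (content r (suc c ∷ w)) η))
      ≋ λ k → ∑± λ s′ → delayed (b s′ c) (dilate (maybeWordSum r n η s′ c)) k
    perLetter c c<r = S.trans
      (∑S.∑-cong (words n r) (λ w → S.reflexive
        (≡.cong (guarded c w) (eqListℕ-increment (λ j → occ (suc j) w) c r η c<r))))
      (perWord c (decAt c η))

  -- Induction on the length: by `N-recurrence` the operator applied to the shorter counts is (1 -
  -- t) N, and the remaining factor D(qt), with D the smaller denominator, completes 1 - t to the
  -- next denominator.
  wordSum≋ : ∀ n s i η → sum η ≡ n → i ℕ.≤ length η →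
    wordSum (length η) n s i η ≋ denominator n ⊛ N s i η
  wordSum≋ zero s i η p i≤r rewrite content-zero η p = S.trans emptyWord (S.sym
    -- For the empty word all coefficients of `N` are 1, so it is the series 1/(1 - t), while
    -- `denominator 0` is 1 - t.
    (oneMinus-⊛ (N s i η) (constant 1#) λ where
      zero    → trans (N-zero s i η 0 p) (sym (+-identityˡ _))
      (suc k) → trans (N-zero s i η (suc k) p)
                  (sym (trans (+-identityʳ _) (N-zero s i η k p)))))
    where
    emptyWord : (λ k → (monomial (localDes 0 s i [] []) k + 0#) + 0#) ≋ constant 1#
    emptyWord zero    = trans (+-identityʳ _) (trans (+-identityʳ _) q^-zero)
    emptyWord (suc k) = trans (+-identityʳ _) (+-identityʳ _)
  wordSum≋ (suc n) s i η p i≤r = S.trans (wordSum-step r n s i η)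
    (S.trans (transfer-cong r s i perLetter)
      (S.trans (S.sym (⊛-transfer r s i (denominator n) (maybeN η)))
        (S.trans (⊛-cong (λ _ → refl) (S.sym (oneMinus-⊛ (N s i η) _
                   (N-recurrence η s i η≢0 i≤r))))
          (S.trans (S.sym (⊛-assoc (dilate (denominator n)) (oneMinus 0) (N s i η)))
            (⊛-cong (S.trans (⊛-comm (dilate (denominator n)) (oneMinus 0))
                             (S.sym (denominator-dilate n))) (λ _ → refl))))))
    where
    r = length η
    η≢0 : sum η ≢ 0
    η≢0 z with () ← ≡.trans (≡.sym p) z
    perLetter : ∀ s′ c → c ℕ.< r → maybeWordSum r n η s′ c ≋ denominator n ⊛ maybeN η s′ c
    perLetter s′ c c<r with decAt c η in eq
    ... | nothing = S.sym (S.zeroʳ (denominator n))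
    ... | just η′ = ≡.subst (λ r → wordSum r n s′ c η′ ≋ denominator n ⊛ N s′ c η′)
                      (decAt-length c η eq)
                      (wordSum≋ n s′ c η′ (ℕₚ.suc-injective (≡.trans (decAt-sum c η eq) p))
                        (ℕₚ.<⇒≤ (≡.subst (c ℕ.<_) (≡.sym (decAt-length c η eq)) c<r)))

  -- The q-binomial sums

  qbin : ℕ → ℕ → Carrier
  qbin m       zero    = 1#
  qbin zero    (suc j) = 0#
  qbin (suc m) (suc j) = qbin m j + q^ (suc j) * qbin m (suc j)

  qbin-vanish : ∀ m j → m ℕ.< j → qbin m j ≈ 0#
  qbin-vanish zero    (suc j) _           = refl
  qbin-vanish (suc m) (suc j) (ℕ.s<s m<j) =
    trans (+-cong (qbin-vanish m j m<j) (*-congˡ (qbin-vanish m (suc j) (ℕₚ.m<n⇒m<1+n m<j))))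
          (trans (+-congˡ (zeroʳ _)) (+-identityˡ _))

  qbin-diagonal : ∀ m → qbin m m ≈ 1#
  qbin-diagonal zero    = refl
  qbin-diagonal (suc m) =
    trans (+-cong (qbin-diagonal m) (*-congˡ (qbin-vanish m (suc m) ℕₚ.≤-refl)))
          (trans (+-congˡ (zeroʳ _)) (+-identityʳ _))

  -- The other q-Pascal rule, with `k` in place of the difference n - m. In the induction both
  -- q-binomials produced by the defining rule are expanded and regrouped; the exponents match
  -- because (m + 2) + k = (k + 1) + (m + 1).
  qbin-dual-pascal : ∀ n k m → n ≡ k ℕ.+ m →
    qbin (suc n) (suc m) ≈ qbin n (suc m) + q^ k * qbin n m
  qbin-dual-pascal n zero m ≡.refl = begin
    qbin (suc m) (suc m)              ≈⟨ qbin-diagonal (suc m) ⟩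
    1#                                ≈⟨ +-identityˡ _ ⟨
    0# + 1#                           ≈⟨ +-congˡ (*-identityˡ _) ⟨
    0# + 1# * 1#
      ≈⟨ +-cong (qbin-vanish m (suc m) ℕₚ.≤-refl) (*-cong q^-zero (qbin-diagonal m)) ⟨
    qbin m (suc m) + q^ 0 * qbin m m  ∎
  qbin-dual-pascal (suc n) (suc k) zero p = begin
    1# + q^ 1 * qbin (suc n) 1
      ≈⟨ +-congˡ (*-congˡ (qbin-dual-pascal n k 0 (ℕₚ.suc-injective p))) ⟩
    1# + q^ 1 * (qbin n 1 + q^ k * 1#)
      ≈⟨ solve 3 (λ u b v → con 1 :+ u :* (b :+ v :* con 1) := (con 1 :+ u :* b) :+ u :* v)
               refl _ _ _ ⟩
    (1# + q^ 1 * qbin n 1) + q^ 1 * q^ k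
      ≈⟨ +-congˡ (trans (sym (q^-+ 1 k)) (sym (*-identityʳ _))) ⟩
    (1# + q^ 1 * qbin n 1) + q^ (suc k) * 1# ∎
  qbin-dual-pascal (suc n) (suc k) (suc m) p = begin
    qbin (suc n) (suc m) + q^ (suc (suc m)) * qbin (suc n) (suc (suc m))
      ≈⟨ +-cong (qbin-dual-pascal n (suc k) m n≡)
                (*-congˡ (qbin-dual-pascal n k (suc m) (ℕₚ.suc-injective p))) ⟩
    (b + q^ (suc k) * a) + q^ (suc (suc m)) * (c′ + q^ k * b)
      ≈⟨ solve 6 (λ b u a v c w → (b :+ u :* a) :+ v :* (c :+ w :* b)
                                := (b :+ u :* a) :+ (v :* c :+ (v :* w) :* b)) refl _ _ _ _ _ _ ⟩
    (b + q^ (suc k) * a) + (q^ (suc (suc m)) * c′ + (q^ (suc (suc m)) * q^ k) * b)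
      ≈⟨ +-congˡ (+-congˡ (*-congʳ exponents)) ⟩
    (b + q^ (suc k) * a) + (q^ (suc (suc m)) * c′ + (q^ (suc k) * q^ (suc m)) * b)
      ≈⟨ solve 6 (λ b u a v c w → (b :+ u :* a) :+ (v :* c :+ (u :* w) :* b)
                                := (b :+ v :* c) :+ u :* (a :+ w :* b)) refl _ _ _ _ _ _ ⟩
    (b + q^ (suc (suc m)) * c′) + q^ (suc k) * (a + q^ (suc m) * b) ∎
    where
    a = qbin n m
    b = qbin n (suc m)
    c′ = qbin n (suc (suc m))
    n≡ : n ≡ suc k ℕ.+ m
    n≡ = ≡.trans (ℕₚ.suc-injective p) (ℕₚ.+-suc k m)
    exponents : q^ (suc (suc m)) * q^ k ≈ q^ (suc k) * q^ (suc m)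
    exponents = trans (sym (q^-+ (suc (suc m)) k))
      (trans (reflexive (≡.cong q^ (≡.trans (ℕₚ.+-comm (suc (suc m)) k) (ℕₚ.+-suc k (suc m)))))
             (q^-+ (suc k) (suc m)))

  -- ∏_{i<m} (1 + q^i t)  and  1 / ∏_{i≤m} (1 − q^i t)
  numeratorSeries binomialSeries : ℕ → Series
  numeratorSeries m j = q^ (tri j) * qbin m j
  binomialSeries  m k = qbin (k ℕ.+ m) m

  -- The q-binomial theorem in recursive form: A_{m+1}(t) = (1 + t) A_m(qt).
  numeratorSeries-suc : ∀ m → numeratorSeries (suc m)
    ≋ λ j → dilate (numeratorSeries m) j + shift (dilate (numeratorSeries m)) j
  numeratorSeries-suc m zero    = begin
    q^ 0 * 1#                    ≈⟨ *-congˡ (trans (*-congʳ q^-zero) (*-identityʳ _)) ⟨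
    q^ 0 * (q^ 0 * 1#)           ≈⟨ +-identityʳ _ ⟨
    q^ 0 * (q^ 0 * 1#) + 0#      ∎
  numeratorSeries-suc m (suc j) = begin
    q^ (tri (suc j)) * (qbin m j + q^ (suc j) * qbin m (suc j))
      ≈⟨ solve 4 (λ t a u b → t :* (a :+ u :* b) := u :* (t :* b) :+ t :* a) refl _ _ _ _ ⟩
    q^ (suc j) * (q^ (tri (suc j)) * qbin m (suc j)) + q^ (tri (suc j)) * qbin m j
      ≈⟨ +-congˡ (trans (*-congʳ (trans (reflexive (≡.cong q^ (tri-suc j))) (q^-+ j (tri j))))
                        (*-assoc _ _ _)) ⟩
    q^ (suc j) * (q^ (tri (suc j)) * qbin m (suc j)) + q^ j * (q^ (tri j) * qbin m j) ∎

  binomialSeries-suc : ∀ m → binomialSeries (suc m)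
    ≋ λ k → shift (binomialSeries (suc m)) k + dilate (binomialSeries m) k
  binomialSeries-suc m zero    = trans (qbin-dual-pascal m 0 m ≡.refl)
    (+-congʳ (qbin-vanish m (suc m) ℕₚ.≤-refl))
  binomialSeries-suc m (suc k) = trans (qbin-dual-pascal (k ℕ.+ suc m) (suc k) m (ℕₚ.+-suc k m))
    (+-congˡ (*-congˡ (reflexive (≡.cong (λ n → qbin n m) (ℕₚ.+-suc k m)))))

  midSeries : ℕ → Series
  midSeries m = numeratorSeries m ⊛ binomialSeries m

  -- Combining the two recursions gives (1 - t) M_{m+1}(t) = (1 + t) M_m(qt), which read
  -- coefficientwise is the recurrence of `T`.
  midSeries-suc : ∀ m → midSeries (suc m)
    ≋ λ k → shift (midSeries (suc m)) k
            + (dilate (midSeries m) k + shift (dilate (midSeries m)) k)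
  midSeries-suc m = S.trans
    (S.trans (⊛-cong {f = A′} (λ _ → refl) (binomialSeries-suc m)) (S.distribˡ A′ (shift B′) dB))
    (S.+-cong (S.trans (⊛-comm A′ (shift B′)) (S.trans (shift-⊛ B′ A′) (shift-cong (⊛-comm B′ A′))))
      (S.trans (⊛-cong (numeratorSeries-suc m) (λ _ → refl))
        (S.trans (⊛-distribʳ dB dA (shift dA))
          (S.+-cong dilated (S.trans (shift-⊛ dA dB) (shift-cong dilated))))))
    where
    A′ B′ dA dB : Series
    A′ = numeratorSeries (suc m)
    B′ = binomialSeries (suc m)
    dA = dilate (numeratorSeries m)
    dB = dilate (binomialSeries m)
    dilated : dA ⊛ dB ≋ dilate (midSeries m)
    dilated = dilate-⊛ (numeratorSeries m) (binomialSeries m)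

  midSeries≋E : ∀ m → midSeries m ≋ E m
  midSeries≋E zero k = trans (⊛-cong one (λ _ → refl) k) (⊛-identityˡ (λ _ → 1#) k)
    where
    one : numeratorSeries 0 ≋ constant 1#
    one zero    = trans (*-congʳ q^-zero) (*-identityʳ _)
    one (suc j) = zeroʳ _
  midSeries≋E (suc m) zero = trans (midSeries-suc m 0)
    (trans (+-identityˡ _) (trans (+-identityʳ _) (*-congˡ (midSeries≋E m 0))))
  midSeries≋E (suc m) (suc k) = begin
    midSeries (suc m) (suc k)
      ≈⟨ midSeries-suc m (suc k) ⟩
    midSeries (suc m) k + (q^ (suc k) * midSeries m (suc k) + q^ k * midSeries m k)
      ≈⟨ +-cong (midSeries≋E (suc m) k)
           (+-cong (*-congˡ (midSeries≋E m (suc k))) (*-congˡ (midSeries≋E m k))) ⟩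
    E (suc m) k + (q^ (suc k) * E m (suc k) + q^ k * E m k)
      ≈⟨ solve 3 (λ a b c → a :+ (b :+ c) := (a :+ c) :+ b) refl _ _ _ ⟩
    (E (suc m) k + q^ k * E m k) + q^ (suc k) * E m (suc k) ∎

  midSum : ℕ → ℕ → Carrier
  midSum k e = ∑< (suc e) λ j → q^ (tri j) * (qbin e j * qbin (k ℕ.+ e ∸ j) e)

  midSum≈E : ∀ k e → midSum k e ≈ E e k
  midSum≈E k e = begin
    ∑< (suc e) term          ≈⟨ ∑<-vanish (suc e) k term beyond-e ⟨
    -- The given sum stops at e and the convolution at k; both are compared with a common longer sum
    -- whose extra terms vanish.
    ∑< (suc e ℕ.+ k) term    ≈⟨ reflexive (≡.cong (λ n → ∑< (suc n) term) (ℕₚ.+-comm e k)) ⟩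
    ∑< (suc k ℕ.+ e) term    ≈⟨ ∑<-vanish (suc k) e term beyond-k ⟩
    ∑< (suc k) term          ≈⟨ ∑<-cong (suc k) inside ⟩
    ∑< (suc k) (λ i → numeratorSeries e i * binomialSeries e (k ∸ i))
                             ≈⟨ ⊛-as-∑ (numeratorSeries e) (binomialSeries e) k ⟨
    midSeries e k            ≈⟨ midSeries≋E e k ⟩
    E e k                    ∎
    where
    term : ℕ → Carrier
    term j = q^ (tri j) * (qbin e j * qbin (k ℕ.+ e ∸ j) e)
    beyond-e : ∀ i → suc e ℕ.≤ i → term i ≈ 0#
    beyond-e i e<i = trans (*-congˡ (trans (*-congʳ (qbin-vanish e i e<i)) (zeroˡ _))) (zeroʳ _)
    beyond-k : ∀ i → suc k ℕ.≤ i → term i ≈ 0#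
    -- The split matters for `e = 0`: there the second q-binomial is 1 even beyond k, and only the
    -- first one vanishes.
    beyond-k i k<i with i ℕ.≤? e
    ... | no  i≰e = beyond-e i (ℕₚ.≰⇒> i≰e)
    ... | yes i≤e = trans (*-congˡ (trans (*-congˡ (qbin-vanish _ e small)) (zeroʳ _))) (zeroʳ _)
      where
      small : k ℕ.+ e ∸ i ℕ.< e
      small = ≡.subst (ℕ._< e) (≡.sym (ℕₚ.+-∸-assoc k i≤e))
        (≡.subst (k ℕ.+ (e ∸ i) ℕ.<_) (ℕₚ.m+[n∸m]≡n i≤e) (ℕₚ.+-monoˡ-< (e ∸ i) k<i))
    inside : ∀ i → i ℕ.< suc k → term i ≈ numeratorSeries e i * binomialSeries e (k ∸ i)
    inside i (ℕ.s≤s i≤k) = trans (sym (*-assoc _ _ _))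
      (*-congˡ (reflexive (≡.cong (λ n → qbin n e) (ℕₚ.+-∸-comm e i≤k))))

  -- Lattice points of the cross polytopes

  ∑-intRange : ∀ K (h : ℕ → Carrier) →
    ∑ (intRange K) (h ∘ ∣_∣) ≈ h 0 + (∑< K (h ∘ suc) + ∑< K (h ∘ suc))
  ∑-intRange K h = trans (∑-applyUpTo (λ i → + i ℤ.- + K) (suc (K ℕ.+ K)) (h ∘ ∣_∣)) (go K)
    where
    g : ℕ → ℕ → Carrier
    g K i = h ∣ + i ℤ.- + K ∣
    go : ∀ K → ∑< (suc (K ℕ.+ K)) (g K) ≈ h 0 + (∑< K (h ∘ suc) + ∑< K (h ∘ suc))
    go zero    = +-congˡ (sym (+-identityˡ _))
    go (suc K) = begin
      -- Passing from K to K + 1 adds one endpoint on each side: the first summand here, and the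
      -- last one, split off below.
      h (suc K) + ∑< (suc (K ℕ.+ suc K)) (g (suc K) ∘ suc)
        ≈⟨ +-congˡ (∑<-cong (suc (K ℕ.+ suc K)) (λ i _ →
             reflexive (≡.cong (h ∘ ∣_∣) (+suc-+suc i K)))) ⟩
      h (suc K) + ∑< (suc (K ℕ.+ suc K)) (g K)
        ≈⟨ +-congˡ (reflexive (≡.cong (λ n → ∑< (suc n) (g K)) (ℕₚ.+-suc K K))) ⟩
      h (suc K) + ∑< (suc (suc (K ℕ.+ K))) (g K)
        ≈⟨ +-congˡ (trans (∑<-last (suc (K ℕ.+ K)) (g K))
             (+-cong (go K) (reflexive (≡.cong h (∣top-K∣ K))))) ⟩
      h (suc K) + ((h 0 + (Y + Y)) + h (suc K))
        ≈⟨ solve 3 (λ a b y → b :+ ((a :+ (y :+ y)) :+ b) := a :+ ((y :+ b) :+ (y :+ b)))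
                 refl _ _ _ ⟩
      h 0 + ((Y + h (suc K)) + (Y + h (suc K)))
        ≈⟨ +-congˡ (+-cong (∑<-last K (h ∘ suc)) (∑<-last K (h ∘ suc))) ⟨
      h 0 + (∑< (suc K) (h ∘ suc) + ∑< (suc K) (h ∘ suc)) ∎
      where Y = ∑< K (h ∘ suc)

  T-cong : ∀ {f g} → (∀ k → f k ≈ g k) → ∀ k → T f k ≈ T g k
  T-cong p zero    = *-congˡ (p 0)
  T-cong p (suc k) = +-cong (+-cong (T-cong p k) (*-congˡ (p k))) (*-congˡ (p (suc k)))

  T-term : (ℕ → Carrier) → ℕ → ℕ → Carrier
  T-term f c i = if i ℕ.≤ᵇ c then q^ (c ∸ i) * f (c ∸ i) else 0#

  T-term-suc : ∀ f c i → T-term f (suc c) (suc i) ≡ T-term f c i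
  T-term-suc f c zero    = ≡.refl
  T-term-suc f c (suc i) = ≡.refl

  -- Every coordinate of `intVecs` runs over the same interval, which may exceed the remaining
  -- budget `c`; the guard in `T-term` discards the excess.
  ∑-T-term : ∀ f c K → c ℕ.≤ K → ∑ (intRange K) (T-term f c ∘ ∣_∣) ≈ T f c
  ∑-T-term f c K c≤K = trans (∑-intRange K (T-term f c)) (go c K c≤K)
    where
    Y : ℕ → ℕ → Carrier
    Y c K = ∑< K (T-term f c ∘ suc)
    go : ∀ c K → c ℕ.≤ K → T-term f c 0 + (Y c K + Y c K) ≈ T f c
    go zero K _ = trans (+-congˡ (trans (+-cong (∑<-zero K) (∑<-zero K)) (+-identityˡ _)))
                        (+-identityʳ _)
    go (suc c) (suc K) (ℕ.s≤s c≤K) = begin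
      T-term f (suc c) 0 + (Y (suc c) (suc K) + Y (suc c) (suc K))
        ≈⟨ +-congˡ (+-cong Y-suc Y-suc) ⟩
      T-term f (suc c) 0 + ((T-term f c 0 + Y c K) + (T-term f c 0 + Y c K))
        ≈⟨ solve 3 (λ a b y → a :+ ((b :+ y) :+ (b :+ y)) := ((b :+ (y :+ y)) :+ b) :+ a)
                 refl _ _ _ ⟩
      ((T-term f c 0 + (Y c K + Y c K)) + q^ c * f c) + q^ (suc c) * f (suc c)
        ≈⟨ +-congʳ (+-congʳ (go c K c≤K)) ⟩
      (T f c + q^ c * f c) + q^ (suc c) * f (suc c) ∎
      where
      Y-suc : Y (suc c) (suc K) ≈ T-term f c 0 + Y c K
      Y-suc = ∑<-cong (suc K) (λ i _ → reflexive (T-term-suc f c i))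

  -- The new `T` is applied innermost, because summing out the head coordinate of a vector replaces
  -- the test function f by `T f`.
  T^ : ℕ → (ℕ → Carrier) → ℕ → Carrier
  T^ zero    f = f
  T^ (suc m) f = T^ m (T f)

  T^-suc : ∀ m f k → T^ (suc m) f k ≈ T (T^ m f) k
  T^-suc zero    f k = refl
  T^-suc (suc m) f k = T^-suc m (T f) k

  E≈T^ : ∀ m k → T^ m (λ _ → 1#) k ≈ E m k
  E≈T^ zero    k = refl
  E≈T^ (suc m) k = trans (T^-suc m _ k) (T-cong (E≈T^ m) k)

  -- The test function f of the remaining budget makes the induction on the dimension possible; f =
  -- 1 gives the weighted point count.
  crossTerm : ℕ → (ℕ → Carrier) → List ℤ → Carrier
  crossTerm k f v = if sum (absList v) ℕ.≤ᵇ k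
    then q^ (mu k (absList v)) * f (k ∸ sum (absList v)) else 0#

  ∑-crossTerm-cons : ∀ k f v →
    ∑ (intRange k) (λ z → crossTerm k f (z ∷ v)) ≈ crossTerm k (T f) v
  ∑-crossTerm-cons k f v with sum (absList v) ℕ.≤ᵇ k in eq
  ... | true  = begin
    ∑ (intRange k) (λ z → crossTerm k f (z ∷ v))
      ≈⟨ ∑-cong (intRange k) (perCoordinate ∘ ∣_∣) ⟩
    ∑ (intRange k) (λ z → q^ μ * T-term f (k ∸ s) ∣ z ∣)
      ≈⟨ ∑-*ˡ (intRange k) (q^ μ) _ ⟩
    q^ μ * ∑ (intRange k) (T-term f (k ∸ s) ∘ ∣_∣)
      ≈⟨ *-congˡ (∑-T-term f (k ∸ s) k (ℕₚ.m∸n≤m k s)) ⟩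
    q^ μ * T f (k ∸ s) ∎
    where
    s = sum (absList v)
    μ = mu k (absList v)
    s≤k : s ℕ.≤ k
    s≤k = ℕₚ.≤ᵇ⇒≤ s k (≡.subst Bool.T (≡.sym eq) tt)
    ∸-swap : ∀ a → k ∸ (a ℕ.+ s) ≡ k ∸ s ∸ a
    ∸-swap a = ≡.trans (≡.cong (k ∸_) (ℕₚ.+-comm a s)) (≡.sym (ℕₚ.∸-+-assoc k s a))
    perCoordinate : ∀ a → (if a ℕ.+ s ℕ.≤ᵇ k
        then q^ (k ∸ (a ℕ.+ s) ℕ.+ μ) * f (k ∸ (a ℕ.+ s)) else 0#)
      ≈ q^ μ * T-term f (k ∸ s) a
    -- The two guards agree only because s ≤ k; otherwise the truncated difference would still admit
    -- a = 0.
    perCoordinate a rewrite ∸-swap a with a ℕ.+ s ℕ.≤ᵇ k in eq₁ | a ℕ.≤ᵇ k ∸ s in eq₂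
    ... | true  | true  = trans (*-congʳ (q^-+ (k ∸ s ∸ a) μ))
      (solve 3 (λ a b c → (a :* b) :* c := b :* (a :* c)) refl _ _ _)
    ... | false | false = sym (zeroʳ _)
    ... | true  | false with () ← ≡.subst Bool.T eq₂
        (ℕₚ.≤⇒≤ᵇ (ℕₚ.m+n≤o⇒m≤o∸n a (ℕₚ.≤ᵇ⇒≤ (a ℕ.+ s) k (≡.subst Bool.T (≡.sym eq₁) tt))))
    ... | false | true  with () ← ≡.subst Bool.T eq₁
        (ℕₚ.≤⇒≤ᵇ (ℕₚ.m≤o∸n⇒m+n≤o a s≤k (ℕₚ.≤ᵇ⇒≤ a (k ∸ s) (≡.subst Bool.T (≡.sym eq₂) tt))))
  ... | false = trans (∑-cong (intRange k) (outside ∘ ∣_∣)) (∑-zero (intRange k))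
    where
    s = sum (absList v)
    outside : ∀ a → (if a ℕ.+ s ℕ.≤ᵇ k
        then q^ (k ∸ (a ℕ.+ s) ℕ.+ mu k (absList v)) * f (k ∸ (a ℕ.+ s)) else 0#) ≈ 0#
    outside a with a ℕ.+ s ℕ.≤ᵇ k in eq₁
    ... | false = refl
    ... | true with () ← ≡.subst Bool.T eq
        (ℕₚ.≤⇒≤ᵇ (ℕₚ.m+n≤o⇒n≤o a (ℕₚ.≤ᵇ⇒≤ (a ℕ.+ s) k (≡.subst Bool.T (≡.sym eq₁) tt))))

  ∑-crossTerm : ∀ m k f → ∑ (intVecs m k) (crossTerm k f) ≈ T^ m f k
  ∑-crossTerm zero    k f = trans (+-identityʳ _) (trans (*-congʳ q^-zero) (*-identityˡ _))
  ∑-crossTerm (suc m) k f = begin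
    ∑ (intVecs (suc m) k) (crossTerm k f)
      ≈⟨ ∑-concatMap _ (intVecs m k) _ ⟩
    ∑ (intVecs m k) (λ v → ∑ (map (_∷ v) (intRange k)) (crossTerm k f))
      ≈⟨ ∑-cong (intVecs m k) (λ v → trans (∑-map (_∷ v) (intRange k) _) (∑-crossTerm-cons k f v)) ⟩
    ∑ (intVecs m k) (crossTerm k (T f))
      ≈⟨ ∑-crossTerm m k (T f) ⟩
    T^ m (T f) k ∎

  ∑-crossPts : ∀ m k → ∑ (crossPts m k) (λ v → q^ (mu k (absList v))) ≈ E m k
  ∑-crossPts m k = begin
    ∑ (crossPts m k) (λ v → q^ (mu k (absList v)))
      ≈⟨ ∑-filter (λ v → sum (absList v) ℕ.≤ᵇ k) (intVecs m k) _ ⟩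
    ∑ (intVecs m k) (λ v → if sum (absList v) ℕ.≤ᵇ k then q^ (mu k (absList v)) else 0#)
      ≈⟨ ∑-cong (intVecs m k) (λ v → times-one (sum (absList v) ℕ.≤ᵇ k)) ⟩
    ∑ (intVecs m k) (crossTerm k (λ _ → 1#))
      ≈⟨ trans (∑-crossTerm m k _) (E≈T^ m k) ⟩
    E m k ∎
    where
    times-one : ∀ b {x} → (if b then x else 0#) ≈ (if b then x * 1# else 0#)
    times-one true  = sym (*-identityʳ _)
    times-one false = refl

  E-product : ℕ → List ℕ → Carrier
  E-product k []      = 1#
  E-product k (e ∷ η) = E e k * E-product k η

  -- Before the first letter the cut is 0, so every factor is `pos k`, that is, `E`.
  N-start : ∀ η k → N true 0 η k ≈ E-product k η
  N-start []      k = refl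
  N-start (e ∷ η) k = *-congˡ (N-start η k)

  ∑-latticePts : ∀ η k → ∑ (latticePts η k) (λ x → q^ (muBar k x)) ≈ E-product k η
  ∑-latticePts []      k = trans (+-identityʳ _) q^-zero
  ∑-latticePts (e ∷ η) k = begin
    ∑ (latticePts (e ∷ η) k) (λ x → q^ (muBar k x))
      ≈⟨ ∑-concatMap _ (crossPts e k) _ ⟩
    ∑ (crossPts e k) (λ v → ∑ (map (v ∷_) (latticePts η k)) (λ x → q^ (muBar k x)))
      ≈⟨ ∑-cong (crossPts e k) (λ v → trans (∑-map (v ∷_) (latticePts η k) _)
           (trans (∑-cong (latticePts η k) (λ x → q^-+ (mu k (absList v)) (muBar k x)))
                  (∑-*ˡ (latticePts η k) _ _))) ⟩
    ∑ (crossPts e k) (λ v → q^ (mu k (absList v)) * ∑ (latticePts η k) (λ x → q^ (muBar k x)))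
      ≈⟨ ∑-*ʳ (crossPts e k) _ _ ⟩
    ∑ (crossPts e k) (λ v → q^ (mu k (absList v))) * ∑ (latticePts η k) (λ x → q^ (muBar k x))
      ≈⟨ *-cong (∑-crossPts e k) (∑-latticePts η k) ⟩
    E e k * E-product k η ∎

-- Standardisation

data Letter (r : ℕ) : ℕ → Set where
  letter : ∀ {c} → c ℕ.< r → Letter r (suc c)

words-letters : ∀ n r → All (All (Letter r)) (words n r)
words-letters zero    r = [] ∷ []
words-letters (suc n) r = Allₚ.concat⁺ (Allₚ.map⁺ (All.map extend (words-letters n r)))
  where
  extend : ∀ {w} → All (Letter r) w → All (All (Letter r)) (applyUpTo (λ c → suc c ∷ w) r)
  extend ls = Allₚ.applyUpTo⁺₁ _ r (λ c<r → letter c<r ∷ ls)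

part : List ℕ → ℕ → ℕ
part []      j       = 0
part (e ∷ η) zero    = e
part (e ∷ η) (suc j) = part η j

eqListℕ⇒part : ∀ (f : ℕ → ℕ) η → eqListℕ (applyUpTo f (length η)) η ≡ true →
  ∀ j → j ℕ.< length η → f j ≡ part η j
eqListℕ⇒part f (e ∷ η) p zero    _ = ≡ᵇ-true (f 0) e (∧-conicalˡ _ _ p)
eqListℕ⇒part f (e ∷ η) p (suc j) (ℕ.s<s j<r) =
  eqListℕ⇒part (λ i → f (suc i)) η (∧-conicalʳ _ _ p) j j<r

occ-head : ∀ c w → occ c (c ∷ w) ≡ suc (occ c w)
occ-head c w with c ≡ᵇ c in eq
... | true  = ≡.refl
... | false with () ← ≡.subst Bool.T eq (ℕₚ.≡⇒≡ᵇ c c ≡.refl)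

-- The first value may be 0, to cover the convention std₀ = 0. The second is positive, so that -v′
-- lies strictly below a nonnegative v even then.
signed-descent : ∀ s s′ b v v′ → 0 ℕ.< v′ → (b ≡ false → v ℕ.< v′) → (b ≡ true → v′ ℕ.< v) →
  (applySign s v >ᵇ applySign s′ v′) ≡ descent s s′ b
signed-descent true true true v v′ _ _ gt with v ℕ.≤ᵇ v′ in eq
... | false = ≡.refl
... | true  = contradiction (ℕₚ.≤ᵇ⇒≤ v v′ (≡.subst Bool.T (≡.sym eq) tt)) (ℕₚ.<⇒≱ (gt ≡.refl))
signed-descent true true false v v′ _ lt _ with v ℕ.≤ᵇ v′ in eq
... | true  = ≡.refl
... | false with () ← ≡.subst Bool.T eq (ℕₚ.≤⇒≤ᵇ (ℕₚ.<⇒≤ (lt ≡.refl)))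
signed-descent true  false b v (suc v′) _ _ _ = ≡.refl
signed-descent false true  b zero    v′ _ _ _ = ≡.refl
signed-descent false true  b (suc v) v′ _ _ _ = ≡.refl
signed-descent false false true zero v′ _ _ gt with () ← gt ≡.refl
signed-descent false false false zero (suc v′) _ _ _ = ≡.refl
signed-descent false false true (suc v) (suc v′) _ _ gt with v′ ℕ.≤ᵇ v in eq
... | true  = ≡.refl
... | false with () ← ≡.subst Bool.T eq (ℕₚ.≤⇒≤ᵇ (ℕₚ.<⇒≤ (ℕ.s<s⁻¹ (gt ≡.refl))))
signed-descent false false false (suc v) (suc v′) _ lt _ with v′ ℕ.≤ᵇ v in eq
... | false = ≡.refl
... | true  = contradiction (ℕₚ.≤ᵇ⇒≤ v′ v (≡.subst Bool.T (≡.sym eq) tt))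
                            (ℕₚ.<⇒≱ (ℕ.s<s⁻¹ (lt ≡.refl)))

module Standardisation (η : List ℕ) where

  offset : ℕ → ℕ
  offset c = sum (take c η)

  value : ℕ → List ℕ → ℕ
  value c pre = offset c ℕ.+ occ (suc c) pre ℕ.+ 1

  offset-suc : ∀ c → offset (suc c) ≡ offset c ℕ.+ part η c
  offset-suc = go η
    where
    go : ∀ η c → sum (take (suc c) η) ≡ sum (take c η) ℕ.+ part η c
    go []      zero    = ≡.refl
    go []      (suc c) = ≡.refl
    go (e ∷ η) zero    = ℕₚ.+-identityʳ e
    go (e ∷ η) (suc c) =
      ≡.trans (≡.cong (e ℕ.+_) (go η c)) (≡.sym (ℕₚ.+-assoc e (sum (take c η)) (part η c)))

  offset-mono : ∀ {c d} → c ℕ.≤ d → offset c ℕ.≤ offset d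
  offset-mono {c} c≤d = go (ℕₚ.≤⇒≤′ c≤d)
    where
    go : ∀ {d} → c ℕ.≤′ d → offset c ℕ.≤ offset d
    go ℕ.≤′-refl               = ℕₚ.≤-refl
    go (ℕ.≤′-step {d} c≤d) = ℕₚ.≤-trans (go c≤d)
      (≡.subst (offset d ℕ.≤_) (≡.sym (offset-suc d)) (ℕₚ.m≤m+n _ _))

  offset<value : ∀ c pre → offset c ℕ.< value c pre
  offset<value c pre = ≡.subst (offset c ℕ.<_) (ℕₚ.+-comm 1 _) (ℕ.s≤s (ℕₚ.m≤m+n _ _))

  value≤offset : ∀ c pre → occ (suc c) pre ℕ.< part η c → value c pre ℕ.≤ offset (suc c)
  value≤offset c pre h = ≡.subst₂ ℕ._≤_
    (≡.trans (ℕₚ.+-suc (offset c) _) (ℕₚ.+-comm 1 _)) (≡.sym (offset-suc c))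
    (ℕₚ.+-monoʳ-≤ (offset c) h)

  -- The invariant of the left-to-right scan: v compares with the next value of each letter as the
  -- index i does, ties counting as larger. Only letters with copies left are considered, since the
  -- formula for an exhausted one would run past its block of values.
  Separated : ℕ → ℕ → List ℕ → Set
  Separated v i pre = ∀ c → occ (suc c) pre ℕ.< part η c →
    (i ℕ.≤ c → v ℕ.< value c pre) × (c ℕ.< i → value c pre ℕ.< v)

  separated-start : Separated 0 0 []
  separated-start c _ = (λ _ → ℕₚ.≤-<-trans ℕ.z≤n (offset<value c [])) , λ ()

  -- Distinct letters occupy disjoint consecutive blocks of values, separated by the offsets; within
  -- one block a later copy receives a larger value.
  separated-step : ∀ c pre → occ (suc c) pre ℕ.< part η c → Separated (value c pre) c (suc c ∷ pre)
  separated-step c pre h d h′ = above , below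
    where
    above : c ℕ.≤ d → value c pre ℕ.< value d (suc c ∷ pre)
    above c≤d with ℕₚ.m≤n⇒m<n∨m≡n c≤d
    ... | inj₁ c<d = ℕₚ.≤-<-trans (ℕₚ.≤-trans (value≤offset c pre h) (offset-mono c<d))
                                  (offset<value d (suc c ∷ pre))
    ... | inj₂ ≡.refl rewrite occ-head (suc c) pre =
      ℕₚ.+-monoˡ-< 1 (ℕₚ.+-monoʳ-< (offset c) (ℕₚ.n<1+n _))
    below : d ℕ.< c → value d (suc c ∷ pre) ℕ.< value c pre
    below d<c = ℕₚ.≤-<-trans (ℕₚ.≤-trans (value≤offset d (suc c ∷ pre) h′) (offset-mono d<c))
                             (offset<value c pre)

  Fits : List ℕ → List ℕ → Set
  Fits pre w = ∀ c → c ℕ.< length η → occ (suc c) pre ℕ.+ occ (suc c) w ≡ part η c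

  fits-room : ∀ c pre w → c ℕ.< length η → Fits pre (suc c ∷ w) → occ (suc c) pre ℕ.< part η c
  fits-room c pre w c<r fits = ≡.subst (occ (suc c) pre ℕ.<_) (fits c c<r)
    (≡.subst (λ m → occ (suc c) pre ℕ.< occ (suc c) pre ℕ.+ m) (≡.sym (occ-head (suc c) w))
      (ℕₚ.m<m+n _ ℕ.z<s))

  fits-step : ∀ c pre w → Fits pre (suc c ∷ w) → Fits (suc c ∷ pre) w
  fits-step c pre w fits d d<r with c ≡ᵇ d | fits d d<r
  ... | true  | p = ≡.trans (≡.sym (ℕₚ.+-suc _ _)) p
  ... | false | p = p

  desGo≡localDes : ∀ j s v i pre w e →
    Separated v i pre → All (Letter (length η)) w → Fits pre w →
    desGo j (applySign s v ∷ zipWith applySign e (stdGo η pre w)) ≡ localDes j s i w e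
  desGo≡localDes j s v i pre []      []       sep _ fits = ≡.refl
  desGo≡localDes j s v i pre []      (_ ∷ _)  sep _ fits = ≡.refl
  desGo≡localDes j s v i pre (c ∷ w) []       sep _ fits = ≡.refl
  desGo≡localDes j s v i pre (suc c ∷ w) (s′ ∷ e) sep (letter c<r ∷ ls) fits
    rewrite signed-descent s s′ (c <ᵇ i) v (value c pre)
              (ℕₚ.≤-<-trans ℕ.z≤n (offset<value c pre))
              (λ b → proj₁ (sep c (fits-room c pre w c<r fits))
                       (ℕₚ.≮⇒≥ λ c<i → ≡.subst Bool.T b (ℕₚ.<⇒<ᵇ c<i)))
              (λ b → proj₂ (sep c (fits-room c pre w c<r fits))
                       (ℕₚ.<ᵇ⇒< c i (≡.subst Bool.T (≡.sym b) tt)))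
          | desGo≡localDes (suc j) s′ (value c pre) c (suc c ∷ pre) w e
              (separated-step c pre (fits-room c pre w c<r fits)) ls (fits-step c pre w fits)
          = ≡.refl

  Des≡localDes : ∀ w e → All (Letter (length η)) w → eqListℕ (content (length η) w) η ≡ true →
    Des η (w ,ε e) ≡ localDes 0 true 0 w e
  Des≡localDes w e ls p = desGo≡localDes 0 true 0 0 [] w e separated-start ls
    (eqListℕ⇒part (λ j → occ (suc j) w) η p)

-- Polynomials in q

module ∑ℤ = FiniteSums ℤₚ.+-*-commutativeRing
module ℤ[[q]] = PowerSeries ℤₚ.+-*-commutativeRing

polyRing : CommutativeRing _ _
polyRing = ℤ[[q]].seriesRing

module Poly = CommutativeRing polyRing
module ∑Poly = FiniteSums polyRing
module Poly[[t]] = PowerSeries polyRing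
open ℤ[[q]] using (_⊛_; _≋_)

qPow-zero : qPow 0 ≋ ℤ[[q]].constant (+ 1)
qPow-zero zero    = ≡.refl
qPow-zero (suc a) = ≡.refl

qPow-+ : ∀ a b → qPow (a ℕ.+ b) ≋ qPow a ⊛ qPow b
qPow-+ zero    b = Poly.sym (Poly.trans (ℤ[[q]].⊛-cong qPow-zero (λ _ → ≡.refl))
                                        (Poly.*-identityˡ (qPow b)))
qPow-+ (suc a) b = Poly.trans (qPow-suc (a ℕ.+ b))
  (Poly.trans (ℤ[[q]].shift-cong (qPow-+ a b))
    (Poly.sym (Poly.trans (ℤ[[q]].⊛-cong (qPow-suc a) (λ _ → ≡.refl))
                          (ℤ[[q]].shift-⊛ (qPow a) (qPow b)))))
  where
  qPow-suc : ∀ d → qPow (suc d) ≋ ℤ[[q]].shift (qPow d)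
  qPow-suc d zero    = ≡.refl
  qPow-suc d (suc a) = ≡.refl

open QSeries polyRing qPow qPow-zero qPow-+

-- Translating the concrete polynomials and counts into the rings

sumTo≡∑< : ∀ n f → sumTo n f ≡ ∑ℤ.∑< (suc n) f
sumTo≡∑< zero    f = ≡.sym (ℤₚ.+-identityʳ _)
sumTo≡∑< (suc n) f =
  ≡.trans (≡.cong (ℤ._+ f (suc n)) (sumTo≡∑< n f)) (≡.sym (∑ℤ.∑<-last (suc n) f))

∑<-at : ∀ n (f : ℕ → Poly) a → ∑Poly.∑< n f a ≡ ∑ℤ.∑< n (λ i → f i a)
∑<-at zero    f a = ≡.refl
∑<-at (suc n) f a = ≡.cong (λ z → f 0 a ℤ.+ z) (∑<-at n (f ∘ suc) a)

∑-at : ∀ {A : Set} (xs : List A) (f : A → Poly) a → ∑Poly.∑ xs f a ≡ ∑ℤ.∑ xs (λ x → f x a)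
∑-at []       f a = ≡.refl
∑-at (x ∷ xs) f a = ≡.cong (λ z → f x a ℤ.+ z) (∑-at xs f a)

polyMul≋ : ∀ f g → polyMul f g ≋ f ⊛ g
polyMul≋ f g a = ≡.trans (sumTo≡∑< a _) (≡.sym (ℤ[[q]].⊛-as-∑ f g a))

polyMul-cong : ∀ {f f′ g g′} → f ≋ f′ → g ≋ g′ → polyMul f g ≋ f′ ⊛ g′
polyMul-cong {f} {f′} {g} p r = Poly.trans (polyMul≋ f g) (ℤ[[q]].⊛-cong p r)

polyOne≋ : polyOne ≋ Poly.1#
polyOne≋ zero    = ≡.refl
polyOne≋ (suc a) = ≡.refl

qbinom≋ : ∀ m j → qbinom m j ≋ qbin m j
qbinom≋ zero    zero    = polyOne≋
qbinom≋ (suc m) zero    = polyOne≋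
qbinom≋ zero    (suc j) = λ _ → ≡.refl
qbinom≋ (suc m) (suc j) = Poly.+-cong (qbinom≋ m j)
  (polyMul-cong (λ _ → ≡.refl) (qbinom≋ m (suc j)))

midFactor≋ : ∀ k e → midFactor k e ≋ E e k
midFactor≋ k e = Poly.trans
  (λ a → ≡.trans (sumTo≡∑< e _) (≡.sym (∑<-at (suc e) term a)))
  (Poly.trans (∑Poly.∑<-cong (suc e) (λ j _ →
      polyMul-cong {qPow (tri j)} (λ _ → ≡.refl)
        (polyMul-cong (qbinom≋ e j) (qbinom≋ (k ℕ.+ e ∸ j) e))))
    (midSum≈E k e))
  where
  term : ℕ → Poly
  term j = polyMul (qPow (tri j)) (polyMul (qbinom e j) (qbinom (k ℕ.+ e ∸ j) e))

Mid≋ : ∀ η k → Mid η k ≋ E-product k η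
Mid≋ []      k = polyOne≋
Mid≋ (e ∷ η) k = polyMul-cong (midFactor≋ k e) (Mid≋ η k)

serMul≋ : ∀ f g → serMul f g Poly[[t]].≋ f Poly[[t]].⊛ g
serMul≋ f g k a = ≡.trans (sumTo≡∑< k _)
  (≡.trans (∑ℤ.∑<-cong (suc k) (λ i _ → polyMul≋ (f i) (g (k ∸ i)) a))
    (≡.trans (≡.sym (∑<-at (suc k) (λ i → f i ⊛ g (k ∸ i)) a)) (≡.sym (Poly[[t]].⊛-as-∑ f g k a))))

factor≋ : ∀ i → factor i Poly[[t]].≋ oneMinus i
factor≋ i zero          = polyOne≋
factor≋ i (suc zero)    = λ _ → ≡.refl
factor≋ i (suc (suc k)) = λ _ → ≡.refl

prodFactors≋ : ∀ n → prodFactors n Poly[[t]].≋ denominator n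
prodFactors≋ zero    = factor≋ 0
prodFactors≋ (suc n) = S.trans (serMul≋ (prodFactors n) (factor (suc n)))
  (Poly[[t]].⊛-cong (prodFactors≋ n) (factor≋ (suc n)))

countᵇ≡∑ : ∀ {A : Set} (p : A → Bool) xs →
  + countᵇ p xs ≡ ∑ℤ.∑ xs (λ x → if p x then + 1 else + 0)
countᵇ≡∑ p []       = ≡.refl
countᵇ≡∑ p (x ∷ xs) with p x
... | true  = ≡.cong (λ z → + 1 ℤ.+ z) (countᵇ≡∑ p xs)
... | false = ≡.trans (countᵇ≡∑ p xs) (≡.sym (ℤₚ.+-identityˡ _))

≡ᵇ-sym : ∀ m n → (m ≡ᵇ n) ≡ (n ≡ᵇ m)
≡ᵇ-sym zero    zero    = ≡.refl
≡ᵇ-sym zero    (suc n) = ≡.refl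
≡ᵇ-sym (suc m) zero    = ≡.refl
≡ᵇ-sym (suc m) (suc n) = ≡ᵇ-sym m n

Ehr≋ : ∀ η k → Ehr η k ≋ E-product k η
Ehr≋ η k a = ≡.trans (countᵇ≡∑ _ (latticePts η k))
  (≡.trans (∑ℤ.∑-cong (latticePts η k) (λ x →
      ≡.cong (if_then + 1 else + 0) (≡ᵇ-sym (muBar k x) a)))
    (≡.trans (≡.sym (∑-at (latticePts η k) _ a)) (∑-latticePts η k a)))

monomial-at : ∀ D k a →
  (if (length D ≡ᵇ k) ∧ (sum D ≡ᵇ a) then + 1 else + 0) ≡ monomial D k a
monomial-at D k a rewrite ≡ᵇ-sym (length D) k | ≡ᵇ-sym (sum D) a with k ≡ᵇ length D
... | true  = ≡.refl
... | false = ≡.refl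

CB≋ : ∀ η → CB η Poly[[t]].≋ wordSum (length η) (sum η) true 0 η
CB≋ η k a = ≡.trans (countᵇ≡∑ p (Bη η))
  (≡.trans (∑ℤ.∑-concatMap _ (Sη η) _)
    (≡.trans (∑ℤ.∑-filter _ (words n r) _)
      -- Replacing standardised descents by local ones requires letters in the range 1, ..., r, so
      -- the comparison is made only over the generated words.
      (≡.trans (∑ℤ.∑-cong-All (All.map perWord (words-letters n r)))
        (≡.sym (≡.trans (∑S-coeff (words n r) _ k a) (∑-at (words n r) _ a))))))
  where
  n = sum η
  r = length η
  p : Signed → Bool
  p x = (des η x ≡ᵇ k) ∧ (maj η x ≡ᵇ a)
  perWord : ∀ {w} → All (Letter r) w →
    (if eqListℕ (content r w) η
       then ∑ℤ.∑ (map (w ,ε_) (signs n)) (λ x → if p x then + 1 else + 0) else + 0)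
    ≡ (if eqListℕ (content r w) η then signSum n true 0 w else (λ _ _ → + 0)) k a
  perWord {w} ls with eqListℕ (content r w) η in eq
  ... | false = ≡.refl
  ... | true  = ≡.trans (∑ℤ.∑-map (w ,ε_) (signs n) _)
    (≡.trans (∑ℤ.∑-cong (signs n) (λ e →
        ≡.trans (monomial-at (Des η (w ,ε e)) k a)
          (≡.cong (λ D → monomial D k a) (Standardisation.Des≡localDes η w e ls eq))))
      (≡.sym (≡.trans (∑S-coeff (signs n) _ k a) (∑-at (signs n) _ a))))

theorem3p2 : (η : List ℕ) → All (λ e → 0 < e) η →
    ((k a : ℕ) → CB η k a ≡ serMul (prodFactors (sum η)) (Mid η) k a)
    × ((k a : ℕ) → Mid η k a ≡ Ehr η k a)
theorem3p2 η _ = CB≡ , λ k → Poly.trans (Mid≋ η k) (Poly.sym (Ehr≋ η k))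
  where
  CB≡ : CB η Poly[[t]].≋ serMul (prodFactors (sum η)) (Mid η)
  CB≡ = S.trans (CB≋ η) (S.trans (wordSum≋ (sum η) true 0 η ≡.refl ℕ.z≤n)
    (S.sym (S.trans (serMul≋ (prodFactors (sum η)) (Mid η))
      (Poly[[t]].⊛-cong (prodFactors≋ (sum η))
        (λ k → Poly.trans (Mid≋ η k) (Poly.sym (N-start η k)))))))
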